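{- Let $\Delta\ge 6$ and let $n=k\Delta+1+j$, where $k\geq\Delta-1$ and $1\leq j\leq\Delta-1$ are integers, and let $r(\Delta)=\frac{1}{2}\left(\sqrt{5\Delta^{2}-32\Delta+44}-\Delta+4\right)$, which is the positive root of the polynomial $q(x)=x^{2}+(\Delta-4)x-(\Delta^{2}-6\Delta+7)$. Then the following holds: (i) $\sigma'>\sigma''$ if $j<r(\Delta)$; (ii) $\sigma'=\sigma''$ if $j=r(\Delta)$; (iii) $\sigma''>\sigma'$ if $j>r(\Delta)$; (iv) for $2\leq j\leq\Delta-2$ it holds that $\sigma'''<\max\{\sigma',\sigma''\}$, except in the following four cases: - if $j=2$ and $\Delta\geq 7$, then $\sigma'''=\sigma'+4>\max\{\sigma',\sigma''\}$; - if $(\Delta,j)=(8,3)$, then $\sigma'''=\sigma'+2>\max\{\sigma',\sigma''\}$; - if $(\Delta,j)=(6,2)$, then $\sigma'''=\sigma''>\sigma'$; - if $(\Delta,j)=(9,3)$, then $\sigma'''=\sigma'>\sigma''$.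
   Context: For a graph $G$, $\sigma(G)=\sum_{uv\in E(G)}(d(u)-d(v))^2$, where $d(u)$ is the degree of $u$. For a tree $T$, $n_i$ is the number of vertices of degree $i$, and $m_{ij}=m_{ji}$ is the number of edges whose end-vertices have degrees $i$ and $j$. An internal leaf of a tree is a vertex of degree at least $2$ having precisely one neighbor of degree greater than $1$. A medium vertex is a vertex whose degree lies in $\{3,\ldots,\Delta-1\}$. Let $n=k\Delta+1+j$. The following families consist of trees $T$ on $n$ vertices with maximum degree $\Delta$. $\mathcal{T}'_{n,\Delta}$: all such trees with (1) all internal leaves of $T$ have degree $\Delta$; (2) $m_{22}\le 2$ and $m_{\Delta\Delta}=0$; (3) $\sum_{i=3}^{\Delta-1}n_i\le 1$; (4) $m_{22}=0$ if and only if $\sum_{i=3}^{\Delta-1}n_i=n_a=1$ for some $a\in\{3,\ldots,\Delta-1\}$; (5) if $m_{22}=0$, then $m_{a2}=a$, where $a$ is the degree from (4). $\mathcal{T}''_{n,\Delta}$: all such trees with (1) all internal leaves of $T$ have degree $\Delta$; (2) all vertices have degree in $\{1,2,\Delta\}$; (3) $m_{22}=0$ and $m_{\Delta\Delta}\le\Delta-1$. $\mathcal{T}'''_{n,\Delta}$ (for $2\le j\le\Delta-2$): all such trees with (1) all internal leaves of $T$ have degree $\Delta$; (2) all vertices have degree in $\{1,2,\Delta\}$, except precisely one medium vertex $w$, which has degree $j+1$; (3) $m_{22}=0$; (4) $w$ has precisely $j$ neighbors of degree $2$ and one neighbor of degree $\Delta$; (5) $m_{\Delta\Delta}=0$. Each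 of these families is nonempty and all its trees have the same $\sigma$-irregularity; the common values are denoted $\sigma'$, $\sigma''$, $\sigma'''$, respectively. Explicitly, writing $B=\Delta^{3}k-2\Delta^{2}k-3\Delta k+6k$: $\sigma'=B+4\Delta-6$ for $j\le 2$ and $\sigma'=B+2\Delta j+j^3-4j^2+j$ for $j\ge 3$; $\sigma''=B-\Delta^{3}+2\Delta^{2}j+6\Delta^{2}-8\Delta j-7\Delta+8j$; $\sigma'''=B+4\Delta+j^3-j^2-6$. -}

module Defs where

open import Data.Empty using (⊥)
open import Data.Bool.Base using (if_then_else_)
open import Data.Fin.Base using (Fin; toℕ)
import Data.Fin.Properties as Fin
import Data.Integer.Base as ℤ
import Data.Integer.Properties as ℤ
open import Data.List.Base using (List; _∷_; length; _∷ʳ_)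
open import Data.List.Relation.Unary.Linked using (Linked)
open import Data.List.Relation.Unary.Unique.Propositional using (Unique)
open import Data.Nat.Base as ℕ using (ℕ; suc)
import Data.Nat.Properties as ℕ
open import Data.Product.Base using (_×_; _,_; ∃; ∃-syntax; proj₁; proj₂)
open import Data.Rational.Base
  using (ℚ; 0ℚ; 1ℚ; ½; _/_; _+_; _*_; _-_; -_; 1/_; _<_; _≤_; NonNegative; positive; nonNegative)
open import Data.Rational.Properties
import Data.Rational.Unnormalised.Base as ℚᵘ
import Data.Rational.Unnormalised.Properties as ℚᵘ
open import Data.Rational.Solver using (module +-*-Solver)
open import Data.Sum.Base using (_⊎_; inj₁; inj₂)
open import Function.Base using (_∘_)
open import Function.Bundles using (_⇔_; mk⇔; Equivalence)
open import Level using (0ℓ)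
open import Relation.Binary.Construct.Closure.ReflexiveTransitive using (Star)
open import Relation.Binary.Definitions using (tri<; tri≈; tri>)
import Relation.Binary.Definitions as B
open import Relation.Binary.PropositionalEquality
  using (_≡_; _≢_; refl; sym; trans; cong; subst; subst₂)
open import Relation.Nullary using (¬_; does; yes; no; contradiction)
open import Relation.Nullary.Decidable using (_×-dec_; _⊎-dec_)
open import Relation.Unary using (Pred; Decidable)
open import Algebra.Properties.CommutativeMonoid.Sum ℕ.+-0-commutativeMonoid
  using (sum-syntax)

record Graph (n : ℕ) : Set₁ where
  field
    Adj    : Fin n → Fin n → Set
    adj?   : B.Decidable Adj
    symm   : ∀ {u v} → Adj u v → Adj v u
    irrefl : ∀ {u} → ¬ Adj u u

count : ∀ {n} {P : Pred (Fin n) 0ℓ} → Decidable P → ℕ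
count {n} P? = ∑[ i < n ] (if does (P? i) then 1 else 0)

module _ {n : ℕ} (G : Graph n) where
  open Graph G

  degree : Fin n → ℕ
  degree v = count (adj? v)

  -- Each edge {u , v} is counted once, as the pair with u < v; only
  -- symmetric f are summed below.
  ∑ₑ : (Fin n → Fin n → ℕ) → ℕ
  ∑ₑ f = ∑[ u < n ] (∑[ v < n ]
           (if does (u Fin.<? v ×-dec adj? u v) then f u v else 0))

  σ : ℕ
  σ = ∑ₑ λ u v → ℕ.∣ degree u - degree v ∣ ℕ.^ 2

  #deg : ℕ → ℕ
  #deg i = count λ v → degree v ℕ.≟ i

  m : ℕ → ℕ → ℕ
  m i j = ∑ₑ λ u v →
    if does ((degree u ℕ.≟ i ×-dec degree v ℕ.≟ j)
             ⊎-dec (degree u ℕ.≟ j ×-dec degree v ℕ.≟ i))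
    then 1 else 0

  Connected : Set
  Connected = ∀ u v → Star Adj u v

  -- The closed walk u, vs, u traverses a cycle of length 1 + length vs.
  IsCycle : Fin n → List (Fin n) → Set
  IsCycle u vs =
    2 ℕ.≤ length vs × Unique (u ∷ vs) × Linked Adj (u ∷ (vs ∷ʳ u))

  Acyclic : Set
  Acyclic = ∀ u vs → ¬ IsCycle u vs

  IsTree : Set
  IsTree = 0 ℕ.< n × Connected × Acyclic

  HasMaxDegree : ℕ → Set
  HasMaxDegree Δ = (∀ v → degree v ℕ.≤ Δ) × ∃[ v ] degree v ≡ Δ

  #neighbours : {P : Pred ℕ 0ℓ} → Decidable P → Fin n → ℕ
  #neighbours P? v = count λ u → adj? v u ×-dec P? (degree u)

  InternalLeaf : Fin n → Set
  InternalLeaf v = 2 ℕ.≤ degree v × #neighbours (1 ℕ.<?_) v ≡ 1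

  InternalLeavesHaveDegree : ℕ → Set
  InternalLeavesHaveDegree Δ = ∀ v → InternalLeaf v → degree v ≡ Δ

  DegreeIn12 : ℕ → Fin n → Set
  DegreeIn12 Δ v = degree v ≡ 1 ⊎ degree v ≡ 2 ⊎ degree v ≡ Δ

  -- The number of vertices with degree in {3, …, Δ - 1}, as the sum of the
  -- numbers #deg i over these i.
  #medium : ℕ → ℕ
  #medium Δ = ∑[ i < Δ ℕ.∸ 3 ] #deg (3 ℕ.+ toℕ i)

  OnlyMediumDegree : ℕ → ℕ → Set
  OnlyMediumDegree Δ a =
    (3 ℕ.≤ a × a ℕ.≤ Δ ℕ.∸ 1) × #medium Δ ≡ #deg a × #deg a ≡ 1

record 𝒯′ (n Δ : ℕ) (T : Graph n) : Set where
  field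
    tree           : IsTree T
    maxDegree      : HasMaxDegree T Δ
    internalLeaves : InternalLeavesHaveDegree T Δ
    m₂₂≤2          : m T 2 2 ℕ.≤ 2
    mΔΔ≡0          : m T Δ Δ ≡ 0
    medium≤1       : #medium T Δ ℕ.≤ 1
    m₂₂≡0⇔medium   : m T 2 2 ≡ 0 ⇔ (∃[ a ] OnlyMediumDegree T Δ a)
    mₐ₂≡a          : m T 2 2 ≡ 0 → ∀ a → OnlyMediumDegree T Δ a → m T a 2 ≡ a

record 𝒯″ (n Δ : ℕ) (T : Graph n) : Set where
  field
    tree           : IsTree T
    maxDegree      : HasMaxDegree T Δ
    internalLeaves : InternalLeavesHaveDegree T Δ
    degrees        : ∀ v → DegreeIn12 T Δ v
    m₂₂≡0          : m T 2 2 ≡ 0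
    mΔΔ≤Δ-1        : m T Δ Δ ℕ.≤ Δ ℕ.∸ 1

-- Used for 2 ≤ j ≤ Δ - 2, so that j + 1 is a medium degree.
record 𝒯‴ (n Δ j : ℕ) (T : Graph n) : Set where
  field
    tree           : IsTree T
    maxDegree      : HasMaxDegree T Δ
    internalLeaves : InternalLeavesHaveDegree T Δ
    w              : Fin n
    degree-w       : degree T w ≡ j ℕ.+ 1
    degrees        : ∀ v → v ≢ w → DegreeIn12 T Δ v
    m₂₂≡0          : m T 2 2 ≡ 0
    w-neighbours₂  : #neighbours T (ℕ._≟ 2) w ≡ j
    w-neighboursΔ  : #neighbours T (ℕ._≟ Δ) w ≡ 1
    mΔΔ≡0          : m T Δ Δ ≡ 0

CommonσValue : ∀ {n} → (Graph n → Set) → ℕ → Set₁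
CommonσValue 𝒯 s = ∃ 𝒯 × (∀ T → 𝒯 T → σ T ≡ s)

-- Dedekind cuts, with only the operations needed to form r Δ below.

record ℝ : Set₁ where
  field
    L U         : ℚ → Set
    L-inhabited : ∃ L
    U-inhabited : ∃ U
    L-rounded   : ∀ p → L p ⇔ (∃[ q ] (p < q × L q))
    U-rounded   : ∀ q → U q ⇔ (∃[ p ] (p < q × U p))
    disjoint    : ∀ p → L p → U p → ⊥
    located     : ∀ p q → p < q → L p ⊎ U q

infix 4 _<ᴿ_ _≈ᴿ_

_<ᴿ_ : ℝ → ℝ → Set
x <ᴿ y = ∃[ q ] (ℝ.U x q × ℝ.L y q)

_≈ᴿ_ : ℝ → ℝ → Set
x ≈ᴿ y = (∀ q → ℝ.L x q ⇔ ℝ.L y q) × (∀ q → ℝ.U x q ⇔ ℝ.U y q)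

ι : ℕ → ℚ
ι n = ℤ.+ n / 1

private
  below : ∀ p → p - 1ℚ < p
  below p = subst (p - 1ℚ <_) (+-identityʳ p) (+-monoʳ-< p (negative⁻¹ (- 1ℚ)))

  above : ∀ p → p < p + 1ℚ
  above p = subst (_< p + 1ℚ) (+-identityʳ p) (+-monoʳ-< p (positive⁻¹ 1ℚ))

fromℚ : ℚ → ℝ
fromℚ a = record
  { L           = _< a
  ; U           = a <_
  ; L-inhabited = a - 1ℚ , below a
  ; U-inhabited = a + 1ℚ , above a
  ; L-rounded   = λ p → mk⇔ <-dense (λ (_ , p<q , q<a) → <-trans p<q q<a)
  ; U-rounded   = λ q → mk⇔ (λ a<q → let (p , a<p , p<q) = <-dense a<q in p , p<q , a<p)
                            (λ (_ , p<q , a<p) → <-trans a<p p<q)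
  ; disjoint    = λ _ → <-asym
  ; located     = loc
  }
  where
  loc : ∀ p q → p < q → p < a ⊎ a < q
  loc p q p<q with p <? a
  ... | yes p<a = inj₁ p<a
  ... | no  p≮a = inj₂ (≤-<-trans (≮⇒≥ p≮a) p<q)

-- Pull a cut back along an increasing bijection f of ℚ with inverse g.
private
  pullback : (f g : ℚ → ℚ) → (∀ q → f (g q) ≡ q) → (∀ q → g (f q) ≡ q) →
             (∀ {p q} → p < q → f p < f q) → (∀ {p q} → p < q → g p < g q) →
             ℝ → ℝ
  pullback f g fg gf f-mono g-mono x = record
    { L           = L ∘ f
    ; U           = U ∘ f
    ; L-inhabited = let (q , Lq) = L-inhabited in g q , subst L (sym (fg q)) Lq
    ; U-inhabited = let (q , Uq) = U-inhabited in g q , subst U (sym (fg q)) Uq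
    ; L-rounded   = λ p → mk⇔
        (λ Lfp → let (q , fp<q , Lq) = Equivalence.to (L-rounded (f p)) Lfp in
          g q , subst (_< g q) (gf p) (g-mono fp<q) , subst L (sym (fg q)) Lq)
        (λ (q , p<q , Lfq) →
          Equivalence.from (L-rounded (f p)) (f q , f-mono p<q , Lfq))
    ; U-rounded   = λ q → mk⇔
        (λ Ufq → let (p , p<fq , Up) = Equivalence.to (U-rounded (f q)) Ufq in
          g p , subst (g p <_) (gf q) (g-mono p<fq) , subst U (sym (fg p)) Up)
        (λ (p , p<q , Ufp) →
          Equivalence.from (U-rounded (f q)) (f p , f-mono p<q , Ufp))
    ; disjoint    = λ p → disjoint (f p)
    ; located     = λ p q p<q → located (f p) (f q) (f-mono p<q)
    }
    where open ℝ x

open +-*-Solver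

infixl 6 _+ᴿ_
infixr 7 ½*_

_+ᴿ_ : ℝ → ℚ → ℝ
x +ᴿ a = pullback (_- a) (_+ a)
  (solve 2 (λ a q → q :+ a :- a := q) refl a)
  (solve 2 (λ a q → q :- a :+ a := q) refl a)
  (+-monoˡ-< (- a)) (+-monoˡ-< a) x

½*_ : ℝ → ℝ
½* x = pullback (ι 2 *_) (½ *_)
  (λ q → trans (sym (*-assoc (ι 2) ½ q)) (*-identityˡ q))
  (λ q → trans (sym (*-assoc ½ (ι 2) q)) (*-identityˡ q))
  (*-monoʳ-<-pos (ι 2)) (*-monoʳ-<-pos ½) x

private
  0<* : ∀ {p q} → 0ℚ < p → 0ℚ < q → 0ℚ < p * q
  0<* {p} {q} 0<p 0<q =
    positive⁻¹ (p * q) {{pos*pos⇒pos p {{positive 0<p}} q {{positive 0<q}}}}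

  0<-to-< : ∀ {p q} → 0ℚ < q - p → p < q
  0<-to-< {p} {q} h = subst₂ _<_ (+-identityʳ p)
    (solve 2 (λ p q → p :+ (q :- p) := q) refl p q) (+-monoʳ-< p h)

  <-to-0< : ∀ {p q} → p < q → 0ℚ < q - p
  <-to-0< {p} {q} h = subst (_< q - p) (+-inverseʳ p) (+-monoˡ-< (- p) h)

  sq-mono-< : ∀ {p q} → 0ℚ ≤ p → p < q → p * p < q * q
  sq-mono-< {p} {q} 0≤p p<q =
    ≤-<-trans (*-monoˡ-≤-nonNeg p {{nonNegative 0≤p}} (<⇒≤ p<q))
              (*-monoˡ-<-pos q {{positive (≤-<-trans 0≤p p<q)}} p<q)

  sq-mono-≤ : ∀ {p q} → 0ℚ ≤ p → p ≤ q → p * p ≤ q * q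
  sq-mono-≤ {p} {q} 0≤p p≤q =
    ≤-trans (*-monoˡ-≤-nonNeg p {{nonNegative 0≤p}} p≤q)
            (*-monoʳ-≤-nonNeg q {{nonNegative (≤-trans 0≤p p≤q)}} p≤q)

  0≤sq : ∀ p → 0ℚ ≤ p → 0ℚ ≤ p * p
  0≤sq p 0≤p = subst (_≤ p * p) (*-zeroˡ 0ℚ) (sq-mono-≤ ≤-refl 0≤p)

  -- For D ≥ 0 and p ≥ 0 put c = D + 1.  Then q = (c p + D) / (p + c) satisfies
  -- (q - p) (p + c) = D - p² and (D - q²) (p + c)² = (D - p²) (c² - D), so q
  -- lies strictly between p and √D.
  module Between (D p : ℚ) (0≤D : 0ℚ ≤ D) (0≤p : 0ℚ ≤ p) where
    c s : ℚ
    c = D + 1ℚ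
    s = p + c

    0<c : 0ℚ < c
    0<c = ≤-<-trans 0≤D (above D)

    0<s : 0ℚ < s
    0<s = subst (_< s) (+-identityˡ 0ℚ) (+-mono-≤-< 0≤p 0<c)

    instance
      s-nonNeg : NonNegative s
      s-nonNeg = nonNegative (<⇒≤ 0<s)

    0≤cp+D : 0ℚ ≤ c * p + D
    0≤cp+D = subst (_≤ c * p + D) (+-identityˡ 0ℚ)
      (+-mono-≤ (subst (_≤ c * p) (*-zeroʳ c)
        (*-monoˡ-≤-nonNeg c {{nonNegative (<⇒≤ 0<c)}} 0≤p)) 0≤D)

    s⁻¹ q : ℚ
    s⁻¹ = (1/ s) {{pos⇒nonZero s {{positive 0<s}}}}
    q = (c * p + D) * s⁻¹

    qs : q * s ≡ c * p + D
    qs = trans (*-assoc (c * p + D) s⁻¹ s)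
         (trans (cong ((c * p + D) *_) (*-inverseˡ s {{pos⇒nonZero s {{positive 0<s}}}}))
                (*-identityʳ (c * p + D)))

    0≤q : 0ℚ ≤ q
    0≤q = *-cancelʳ-≤-pos s {{positive 0<s}}
      (subst₂ _≤_ (sym (*-zeroˡ s)) (sym qs) 0≤cp+D)

    0<c²-D : 0ℚ < c * c - D
    0<c²-D = subst (0ℚ <_)
      (solve 1 (λ D → D :* D :+ (D :+ con 1ℚ) := (D :+ con 1ℚ) :* (D :+ con 1ℚ) :- D) refl D)
      (subst (_< D * D + (D + 1ℚ)) (+-identityˡ 0ℚ) (+-mono-≤-< (0≤sq D 0≤D) 0<c))

    qqss : (q * q) * (s * s) ≡ (c * p + D) * (c * p + D)
    qqss = trans (solve 2 (λ q s → (q :* q) :* (s :* s) := (q :* s) :* (q :* s)) refl q s)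
                 (cong (λ t → t * t) qs)

    instance
      ss-nonNeg : NonNegative (s * s)
      ss-nonNeg = nonNegative (<⇒≤ (0<* 0<s 0<s))

    up : p * p < D → p < q × q * q < D
    up h = *-cancelʳ-<-nonNeg s (subst (p * s <_) (sym qs)
             (0<-to-< (subst (0ℚ <_)
               (solve 3 (λ p D c → D :- p :* p := c :* p :+ D :- p :* (p :+ c)) refl p D c)
               (<-to-0< h))))
         , *-cancelʳ-<-nonNeg (s * s) (subst (_< D * (s * s)) (sym qqss)
             (0<-to-< (subst (0ℚ <_)
               (solve 3 (λ p D c → (D :- p :* p) :* (c :* c :- D) :=
                  D :* ((p :+ c) :* (p :+ c)) :- (c :* p :+ D) :* (c :* p :+ D)) refl p D c)
               (0<* (<-to-0< h) 0<c²-D))))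

    down : D < p * p → q < p × D < q * q
    down h = *-cancelʳ-<-nonNeg s (subst (_< p * s) (sym qs)
             (0<-to-< (subst (0ℚ <_)
               (solve 3 (λ p D c → p :* p :- D := p :* (p :+ c) :- (c :* p :+ D)) refl p D c)
               (<-to-0< h))))
         , *-cancelʳ-<-nonNeg (s * s) (subst (D * (s * s) <_) (sym qqss)
             (0<-to-< (subst (0ℚ <_)
               (solve 3 (λ p D c → (p :* p :- D) :* (c :* c :- D) :=
                  (c :* p :+ D) :* (c :* p :+ D) :- D :* ((p :+ c) :* (p :+ c))) refl p D c)
               (0<* (<-to-0< h) 0<c²-D))))

-- For D < 0 this is 0.
√ : ℚ → ℝ
√ D = record
  { L           = L
  ; U           = U
  ; L-inhabited = - 1ℚ , inj₁ (negative⁻¹ (- 1ℚ))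
  ; U-inhabited = U-inh
  ; L-rounded   = λ p → mk⇔ (L-up p) (λ (q , p<q , Lq) → L-down p<q Lq)
  ; U-rounded   = λ q → mk⇔ (U-down q)
      (λ (p , p<q , 0<p , D<p²) →
        <-trans 0<p p<q , <-trans D<p² (sq-mono-< (<⇒≤ 0<p) p<q))
  ; disjoint    = dis
  ; located     = loc
  }
  where
  L U : ℚ → Set
  L q = q < 0ℚ ⊎ q * q < D
  U q = 0ℚ < q × D < q * q

  U-inh : ∃ U
  U-inh with 0ℚ ≤? D
  ... | yes 0≤D = D + 1ℚ , ≤-<-trans 0≤D (above D) ,
                  0<-to-< (Between.0<c²-D D 0ℚ 0≤D ≤-refl)
  ... | no  0≰D = 1ℚ , positive⁻¹ 1ℚ , <-trans (≰⇒> 0≰D) (positive⁻¹ 1ℚ)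

  L-up : ∀ p → L p → ∃[ q ] (p < q × L q)
  L-up p (inj₁ p<0) = let (q , p<q , q<0) = <-dense p<0 in q , p<q , inj₁ q<0
  L-up p (inj₂ p²<D) with p <? 0ℚ
  ... | yes p<0 = L-up p (inj₁ p<0)
  ... | no  p≮0 = q , proj₁ (up p²<D) , inj₂ (proj₂ (up p²<D))
    where
    0≤p : 0ℚ ≤ p
    0≤p = ≮⇒≥ p≮0
    open Between D p (≤-trans (0≤sq p 0≤p) (<⇒≤ p²<D)) 0≤p

  L-down : ∀ {p q} → p < q → L q → L p
  L-down p<q (inj₁ q<0) = inj₁ (<-trans p<q q<0)
  L-down {p} p<q (inj₂ q²<D) with p <? 0ℚ
  ... | yes p<0 = inj₁ p<0
  ... | no  p≮0 = inj₂ (<-trans (sq-mono-< (≮⇒≥ p≮0) p<q) q²<D)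

  U-down : ∀ q → U q → ∃[ p ] (p < q × U p)
  U-down r (0<r , D<r²) with 0ℚ <? D
  ... | no  0≮D = let (p , 0<p , p<r) = <-dense 0<r in
                  p , p<r , 0<p , ≤-<-trans (≮⇒≥ 0≮D) (0<* 0<p 0<p)
  ... | yes 0<D = q , proj₁ (down D<r²) , 0<q , proj₂ (down D<r²)
    where
    open Between D r (<⇒≤ 0<D) (<⇒≤ 0<r)
    0<q : 0ℚ < q
    0<q with <-cmp 0ℚ q
    ... | tri< 0<q _ _ = 0<q
    ... | tri≈ _ 0≡q _ = contradiction
      (<-trans 0<D (subst (λ t → D < t * t) (sym 0≡q) (proj₂ (down D<r²)))) (<-irrefl refl)
    ... | tri> _ _ q<0 = contradiction (<-≤-trans q<0 0≤q) (<-irrefl refl)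

  dis : ∀ p → L p → U p → ⊥
  dis p (inj₁ p<0)  (0<p , _)    = <-asym p<0 0<p
  dis p (inj₂ p²<D) (_   , D<p²) = <-asym p²<D D<p²

  loc : ∀ p q → p < q → L p ⊎ U q
  loc p q p<q with p <? 0ℚ
  ... | yes p<0 = inj₁ (inj₁ p<0)
  ... | no  p≮0 with D <? q * q
  ...   | yes D<q² = inj₂ (≤-<-trans (≮⇒≥ p≮0) p<q , D<q²)
  ...   | no  D≮q² = inj₁ (inj₂ (<-≤-trans (sq-mono-< (≮⇒≥ p≮0) p<q) (≮⇒≥ D≮q²)))

r : ℕ → ℝ
r Δ = ½* (√ (ι 5 * (d * d) - ι 32 * d + ι 44) +ᴿ (- d) +ᴿ ι 4)
  where
  d : ℚ
  d = ι Δ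

qpoly : ℕ → ℚ → ℚ
qpoly Δ x = x * x + (d - ι 4) * x - (d * d - ι 6 * d + ι 7)
  where
  d : ℚ
  d = ι Δ

private
  ι-mono : ∀ {a b} → a ℕ.≤ b → ι a ≤ ι b
  ι-mono {a} {b} a≤b = toℚᵘ-cancel-≤
    (ℚᵘ.≤-respˡ-≃ (ℚᵘ.≃-sym (toℚᵘ-fromℚᵘ (ℚᵘ.mkℚᵘ (ℤ.+ a) 0)))
    (ℚᵘ.≤-respʳ-≃ (ℚᵘ.≃-sym (toℚᵘ-fromℚᵘ (ℚᵘ.mkℚᵘ (ℤ.+ b) 0)))
      (ℚᵘ.*≤* (ℤ.*-monoʳ-≤-nonNeg (ℤ.+ 1) (ℤ.+≤+ a≤b)))))

  -- 4 q(x) = (2x + Δ - 4)² - (5Δ² - 32Δ + 44)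
  complete-square : ∀ d x →
    ι 4 * (x * x + (d - ι 4) * x - (d * d - ι 6 * d + ι 7)) ≡
    (ι 2 * x - ι 4 - (- d)) * (ι 2 * x - ι 4 - (- d)) - (ι 5 * (d * d) - ι 32 * d + ι 44)
  complete-square = solve 2 (λ d x →
    con (ι 4) :* (x :* x :+ (d :- con (ι 4)) :* x :- (d :* d :- con (ι 6) :* d :+ con (ι 7))) :=
    (con (ι 2) :* x :- con (ι 4) :- (:- d)) :* (con (ι 2) :* x :- con (ι 4) :- (:- d))
      :- (con (ι 5) :* (d :* d) :- con (ι 32) :* d :+ con (ι 44))) refl

  <0-from-> : ∀ {p q} → p < q → p - q < 0ℚ
  <0-from-> {p} {q} h = subst (p - q <_) (+-inverseʳ q) (+-monoˡ-< (- q) h)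

  >-from-<0 : ∀ {p q} → p - q < 0ℚ → p < q
  >-from-<0 {p} {q} h = subst₂ _<_ (solve 2 (λ p q → p :- q :+ q := p) refl p q)
    (+-identityˡ q) (+-monoˡ-< q h)

-- On the rationals x > 0, r Δ is the point where qpoly Δ changes sign from
-- negative to positive, that is, its positive root.
r-root : ∀ Δ → 6 ℕ.≤ Δ → ∀ x → 0ℚ < x →
         (ℝ.L (r Δ) x ⇔ qpoly Δ x < 0ℚ) × (ℝ.U (r Δ) x ⇔ 0ℚ < qpoly Δ x)
r-root Δ 6≤Δ x 0<x = lower , upper
  where
  d D s : ℚ
  d = ι Δ
  D = ι 5 * (d * d) - ι 32 * d + ι 44
  s = ι 2 * x - ι 4 - (- d)

  0<s : 0ℚ < s
  0<s = subst (0ℚ <_) (solve 2 (λ d x → (con (ι 2) :* x) :+ (d :- con (ι 4))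
                         := con (ι 2) :* x :- con (ι 4) :- (:- d)) refl d x)
    (subst (_< ι 2 * x + (d - ι 4)) (+-identityˡ 0ℚ)
      (+-mono-<-≤ (0<* (positive⁻¹ (ι 2)) 0<x)
        (subst (_≤ d - ι 4) (+-inverseʳ (ι 4)) (+-monoˡ-≤ (- ι 4) (ι-mono (ℕ.≤-trans (ℕ.m≤m+n 4 2) 6≤Δ))))))

  lower : ℝ.L (r Δ) x ⇔ qpoly Δ x < 0ℚ
  lower = mk⇔ to from
    where
    to : s < 0ℚ ⊎ s * s < D → qpoly Δ x < 0ℚ
    to (inj₁ s<0)  = contradiction s<0 (<-asym 0<s)
    to (inj₂ s²<D) = *-cancelˡ-<-nonNeg (ι 4)
      (subst₂ _<_ (sym (complete-square d x)) (sym (*-zeroʳ (ι 4))) (<0-from-> s²<D))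
    from : qpoly Δ x < 0ℚ → s < 0ℚ ⊎ s * s < D
    from q<0 = inj₂ (>-from-<0
      (subst₂ _<_ (complete-square d x) (*-zeroʳ (ι 4)) (*-monoʳ-<-pos (ι 4) q<0)))

  upper : ℝ.U (r Δ) x ⇔ 0ℚ < qpoly Δ x
  upper = mk⇔ to from
    where
    to : 0ℚ < s × D < s * s → 0ℚ < qpoly Δ x
    to (_ , D<s²) = *-cancelˡ-<-nonNeg (ι 4)
      (subst₂ _<_ (sym (*-zeroʳ (ι 4))) (sym (complete-square d x))
        (<-to-0< {D} {s * s} D<s²))
    from : 0ℚ < qpoly Δ x → 0ℚ < s × D < s * s
    from 0<q = 0<s , 0<-to-< {D} {s * s}
      (subst₂ _<_ (*-zeroʳ (ι 4)) (complete-square d x) (*-monoʳ-<-pos (ι 4) 0<q))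

r-positive : ∀ Δ → 6 ℕ.≤ Δ → fromℚ 0ℚ <ᴿ r Δ
r-positive Δ 6≤Δ = 1ℚ , positive⁻¹ 1ℚ ,
  Equivalence.from (proj₁ (r-root Δ 6≤Δ 1ℚ (positive⁻¹ 1ℚ)))
    (subst (_< 0ℚ) (solve 1 (λ d → :- ((d :- con (ι 2)) :* (d :- con (ι 5))) :=
         con 1ℚ :* con 1ℚ :+ (d :- con (ι 4)) :* con 1ℚ
           :- (d :* d :- con (ι 6) :* d :+ con (ι 7))) refl (ι Δ))
      (neg-antimono-< (0<* (<-to-0< 2<d) (<-to-0< 5<d))))
  where
  2<d : ι 2 < ι Δ
  2<d = <-≤-trans (above (ι 2)) (ι-mono (ℕ.≤-trans (ℕ.m≤m+n 3 3) 6≤Δ))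
  5<d : ι 5 < ι Δ
  5<d = <-≤-trans (above (ι 5)) (ι-mono 6≤Δ)

{-# OPTIONS --safe #-}
module Submission where

-- In the three families a leaf is adjacent only to a vertex of degree Δ, so an edge
-- joins degrees {1,Δ}, {2,2}, {2,a}, {2,Δ}, {a,Δ} or {Δ,Δ}, where a is the degree of the
-- medium vertex.  For such an edge both 1 and the squared difference of the degrees
-- are, up to the numbers of edges of type 22, 2a, aΔ and ΔΔ, sums of contributions of
-- the two ends; summing over all edges expresses n - 1 and σ by n₁, n₂ and these
-- numbers.  With the vertex count and the degree sum 2(n - 1) this determines n₁ and n₂
-- and leaves an equation modulo Δ, which fixes nΔ and the remaining parameters.
-- From the resulting values, σ″ - σ′ = (Δ - j) q(j) for j ≥ 2, and with i = j - 2 and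
-- c = Δ - j, σ‴ - σ′ = i (i + 7 - 2 c) + 4; the cases of (iv) are read off from the latter.

open import Defs
open import Data.Nat using (ℕ; _+_; _*_; _∸_; _≤_; _<_; _⊔_)
open import Data.Product using (_×_; _,_)
open import Relation.Binary.PropositionalEquality using (_≡_)
open import Relation.Nullary using (¬_)
open import Data.Sum using (_⊎_)

open import Data.Nat.Properties
open import Algebra.Properties.Semiring.Sum +-*-semiring
  using (sum; ∑-distrib-+; ∑-comm; sum-cong-≗; *-distribˡ-sum)
open import Data.Bool.Base using (true; false; _∧_; _∨_; if_then_else_)
open import Data.Bool.Properties using (∧-comm; ∨-comm)
open import Data.Fin.Base as Fin using (Fin; zero; suc; toℕ; fromℕ<)
import Data.Fin.Properties as Fin
import Data.Integer.Base as ℤ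
import Data.Integer.Properties as ℤ
open import Data.Integer.Tactic.RingSolver using () renaming (solve-∀ to solveℤ-∀)
open import Data.List.Base using (List; []; _∷_; _++_; _∷ʳ_; length; map; tabulate; allFin)
open import Data.List.Membership.Propositional using (_∈_; _∉_)
open import Data.List.Membership.Propositional.Properties
  using (∈-++⁺ˡ; ∈-++⁻; ∈-∃++; ∈-allFin)
import Data.List.Properties as List
open import Data.List.Relation.Binary.Permutation.Propositional
  using (_↭_; ↭-refl; ↭-sym; ↭-trans; ↭-reflexive; ↭⇒↭ₛ)
open import Data.List.Relation.Binary.Permutation.Propositional.Properties
  using (shift; map⁺; ++⁺ˡ; ∈-resp-↭; ↭-length)
import Data.List.Relation.Binary.Permutation.Setoid.Properties as Permₛ
open import Data.List.Relation.Unary.All as All using ([]; _∷_)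
open import Data.List.Relation.Unary.All.Properties using (¬Any⇒All¬)
open import Data.List.Relation.Unary.AllPairs using ([]; _∷_)
open import Data.List.Relation.Unary.Any using (here; there)
open import Data.List.Relation.Unary.Linked using (Linked; [-]; _∷_)
open import Data.List.Relation.Unary.Unique.Propositional using (Unique)
import Data.List.Relation.Unary.Unique.Propositional.Properties as Unique
open import Data.Nat
  using (zero; suc; _^_; ∣_-_∣; z≤n; s≤s; s≤s⁻¹; _≟_; _<?_; _≤?_; _≡ᵇ_)
import Data.Nat.ListAction as List
open import Data.Nat.ListAction.Properties using (sum-↭)
open import Data.Nat.Tactic.RingSolver using (solve-∀)
open import Data.Product using (∃-syntax; proj₁; proj₂)
import Data.Rational.Base as ℚ
import Data.Rational.Properties as ℚ
open import Data.Rational.Solver using (module +-*-Solver)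
import Data.Rational.Unnormalised.Base as ℚᵘ
import Data.Rational.Unnormalised.Properties as ℚᵘ
open import Data.Sum using (inj₁; inj₂)
open import Function.Base using (_∘_)
open import Function.Bundles using (Equivalence)
open import Level using (0ℓ)
open import Relation.Binary.Construct.Closure.ReflexiveTransitive using (Star; ε; _◅_)
open import Relation.Binary.Definitions using (tri<; tri≈; tri>)
open import Relation.Binary.PropositionalEquality
  using (_≢_; refl; sym; trans; cong; cong₂; subst; subst₂; setoid; module ≡-Reasoning)
open import Relation.Nullary using (Dec; does; yes; no; contradiction)
open import Relation.Nullary.Decidable using (dec-true; dec-false; _×-dec_; _⊎-dec_)
open import Relation.Unary using (Pred; Decidable)

-- The values are derived from the trees: `CommonσValue` supplies one member of each family, and
-- counting in that member gives the common value. The count depends on leaves being adjacent only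
-- to vertices of degree Δ. A neighbour of degree 2 would be an internal leaf of too small a degree,
-- and the neighbours of a medium vertex are fixed by the family. The degree sum 2(n - 1) has to be
-- proved, since trees are defined by connectedness and acyclicity; this is done by growing a
-- subtree one vertex at a time. All counting takes place in ℕ. Negative terms are therefore moved
-- across each equation, and the parameters are shifted until differences become variables: d = Δ -
-- 2, b = a - 2, i = j - 2, c = Δ - j. The real number r(Δ) enters only through the sign of q at the
-- integer j, which is again an inequality in ℕ.

-- Finite sums over `Fin n` and over lists.

sum-zero : ∀ {n} (f : Fin n → ℕ) → (∀ i → f i ≡ 0) → sum f ≡ 0
sum-zero {zero}  f f≡0 = refl
sum-zero {suc n} f f≡0 = cong₂ _+_ (f≡0 zero) (sum-zero (f ∘ suc) (f≡0 ∘ suc))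

term≤sum : ∀ {n} (f : Fin n → ℕ) i → f i ≤ sum f
term≤sum f zero    = m≤m+n _ _
term≤sum f (suc i) = m≤n⇒m≤o+n _ (term≤sum (f ∘ suc) i)

sum≡0⇒term≡0 : ∀ {n} (f : Fin n → ℕ) → sum f ≡ 0 → ∀ i → f i ≡ 0
sum≡0⇒term≡0 f eq i = n≤0⇒n≡0 (subst (f i ≤_) eq (term≤sum f i))

two-terms≤sum : ∀ {n} (f : Fin n → ℕ) {i k} → i ≢ k → f i + f k ≤ sum f
two-terms≤sum f {zero}  {zero}  i≢k = contradiction refl i≢k
two-terms≤sum f {zero}  {suc k} i≢k = +-monoʳ-≤ _ (term≤sum (f ∘ suc) k)
two-terms≤sum f {suc i} {zero}  i≢k =
  subst (_≤ sum f) (+-comm (f zero) _) (+-monoʳ-≤ _ (term≤sum (f ∘ suc) i))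
two-terms≤sum f {suc i} {suc k} i≢k =
  m≤n⇒m≤o+n _ (two-terms≤sum (f ∘ suc) (i≢k ∘ cong suc))

sum-single : ∀ {n} (f : Fin n → ℕ) i → (∀ k → k ≢ i → f k ≡ 0) → sum f ≡ f i
sum-single f zero    f≡0 =
  trans (cong (f zero +_) (sum-zero (f ∘ suc) λ k → f≡0 (suc k) λ ())) (+-identityʳ _)
sum-single f (suc i) f≡0 = cong₂ _+_ (f≡0 zero λ ())
  (sum-single (f ∘ suc) i λ k k≢i → f≡0 (suc k) (k≢i ∘ Fin.suc-injective))

sum-positive : ∀ {n} (f : Fin n → ℕ) → 0 < sum f → ∃[ i ] 0 < f i
sum-positive {suc n} f 0<s with f zero in eq
... | suc _ = zero , subst (0 <_) (sym eq) (s≤s z≤n)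
... | zero  = let (i , 0<fi) = sum-positive (f ∘ suc) 0<s in suc i , 0<fi

sum-mono : ∀ {n} {f g : Fin n → ℕ} → (∀ i → f i ≤ g i) → sum f ≤ sum g
sum-mono {zero}  f≤g = z≤n
sum-mono {suc n} f≤g = +-mono-≤ (f≤g zero) (sum-mono (f≤g ∘ suc))

sum-tabulate : ∀ {n} (f : Fin n → ℕ) {A : Set} (g : Fin n → A) (h : A → ℕ) →
  (∀ i → h (g i) ≡ f i) → List.sum (map h (tabulate g)) ≡ sum f
sum-tabulate {zero}  f g h eq = refl
sum-tabulate {suc n} f g h eq = cong₂ _+_ (eq zero) (sum-tabulate (f ∘ suc) (g ∘ suc) h (eq ∘ suc))

sum-allFin : ∀ {n} (f : Fin n → ℕ) → List.sum (map f (allFin n)) ≡ sum f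
sum-allFin f = sum-tabulate f (λ i → i) f λ _ → refl

sum-map-+ : ∀ {A : Set} (f g : A → ℕ) xs →
  List.sum (map (λ x → f x + g x) xs) ≡ List.sum (map f xs) + List.sum (map g xs)
sum-map-+ f g []       = refl
sum-map-+ f g (x ∷ xs) = trans (cong (f x + g x +_) (sum-map-+ f g xs))
  (interchange (f x) (g x) _ _)
  where
  interchange : ∀ a b c d → a + b + (c + d) ≡ a + c + (b + d)
  interchange = solve-∀

-- The degree sum of a tree.

module _ {n : ℕ} (G : Graph n) where
  open Graph G

  adj : Fin n → Fin n → ℕ
  adj u v = if does (adj? u v) then 1 else 0

  adj-true : ∀ {u v} → Adj u v → adj u v ≡ 1
  adj-true {u} {v} e = cong (if_then 1 else 0) (dec-true (adj? u v) e)

  adj-false : ∀ {u v} → ¬ Adj u v → adj u v ≡ 0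
  adj-false {u} {v} ¬e = cong (if_then 1 else 0) (dec-false (adj? u v) ¬e)

  adj-comm : ∀ u v → adj u v ≡ adj v u
  adj-comm u v with adj? u v
  ... | yes e = sym (adj-true (symm e))
  ... | no ¬e = sym (adj-false (¬e ∘ symm))

  row : Fin n → List (Fin n) → ℕ
  row v xs = List.sum (map (adj v) xs)

  -- Twice the number of edges inside `xs`; for the list of all vertices it is the degree sum.
  within : List (Fin n) → ℕ
  within xs = List.sum (map (λ u → row u xs) xs)

  within-∷ : ∀ v xs → within (v ∷ xs) ≡ row v xs + row v xs + within xs
  within-∷ v xs = begin
    adj v v + row v xs + List.sum (map (λ u → adj u v + row u xs) xs)
      ≡⟨ cong₂ _+_ (cong (_+ row v xs) (adj-false irrefl))
           (sum-map-+ (λ u → adj u v) (λ u → row u xs) xs) ⟩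
    row v xs + (List.sum (map (λ u → adj u v) xs) + within xs)
      ≡⟨ cong (λ t → row v xs + (List.sum t + within xs))
           (List.map-cong (λ u → adj-comm u v) xs) ⟩
    row v xs + (row v xs + within xs)
      ≡⟨ +-assoc (row v xs) _ _ ⟨
    row v xs + row v xs + within xs ∎
    where open ≡-Reasoning

  within-↭ : ∀ {xs ys} → xs ↭ ys → within xs ≡ within ys
  within-↭ {xs} {ys} p = trans
    (cong List.sum (List.map-cong (λ u → sum-↭ (map⁺ (adj u) p)) xs))
    (sum-↭ (map⁺ (λ u → row u ys) p))

  row-zero : ∀ {v} xs → (∀ {y} → y ∈ xs → ¬ Adj v y) → row v xs ≡ 0
  row-zero []       _  = refl
  row-zero (x ∷ xs) ¬e = cong₂ _+_ (adj-false (¬e (here refl))) (row-zero xs (¬e ∘ there))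

  row-one : ∀ {v x xs} → Unique xs → x ∈ xs → Adj v x →
            (∀ {y} → y ∈ xs → y ≢ x → ¬ Adj v y) → row v xs ≡ 1
  row-one (x∉xs ∷ _) (here refl) e ¬e = cong₂ _+_ (adj-true e)
    (row-zero _ λ y∈xs → ¬e (there y∈xs) λ y≡x → All.lookup x∉xs y∈xs (sym y≡x))
  row-one (y∉xs ∷ u) (there x∈xs) e ¬e = cong₂ _+_
    (adj-false (¬e (here refl) (All.lookup y∉xs x∈xs)))
    (row-one u x∈xs e (¬e ∘ there))

  data Path : Fin n → Fin n → List (Fin n) → Set where
    stop : ∀ {x} → Path x x (x ∷ [])
    step : ∀ {x y z p} → Adj x y → Path y z p → Path x z (x ∷ p)

  path-snoc : ∀ {x y z p} → Path x y p → Adj y z → Path x z (p ∷ʳ z)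
  path-snoc stop       e′ = step e′ stop
  path-snoc (step e p) e′ = step e (path-snoc p e′)

  path-linked : ∀ {u x y v p} → Adj u x → Path x y p → Adj y v → Linked Adj (u ∷ (p ∷ʳ v))
  path-linked e stop        e′ = e ∷ e′ ∷ [-]
  path-linked e (step e₁ p) e′ = e ∷ path-linked e₁ p e′

  path-long : ∀ {x y p} → x ≢ y → Path x y p → 2 ≤ length p
  path-long x≢y stop                = contradiction refl x≢y
  path-long x≢y (step _ stop)       = s≤s (s≤s z≤n)
  path-long x≢y (step _ (step _ _)) = s≤s (s≤s z≤n)

  Joined : List (Fin n) → Fin n → Fin n → Set
  Joined xs x y = ∃[ p ] Path x y p × Unique p × (∀ {z} → z ∈ p → z ∈ xs)

  -- The path stays in `xs`, so `v` is new to it, and distinct ends give it the two vertices that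
  -- `IsCycle` demands; the two edges at `v` close it.
  joined-cycle : ∀ {xs v x y} → v ∉ xs → x ≢ y → Adj v x → Adj v y → Joined xs x y →
                 ∃[ p ] IsCycle G v p
  joined-cycle v∉xs x≢y e e′ (p , path , uniq , p⊆xs) =
    p , path-long x≢y path , ¬Any⇒All¬ p (v∉xs ∘ p⊆xs) ∷ uniq , path-linked e path (symm e′)

  joined-refl : ∀ {xs v} → Joined (v ∷ xs) v v
  joined-refl = _ , stop , ([] ∷ []) , λ { (here refl) → here refl }

  joined-weaken : ∀ {v xs x y} → Joined xs x y → Joined (v ∷ xs) x y
  joined-weaken (p , path , uniq , p⊆xs) = p , path , uniq , there ∘ p⊆xs

  joined-cons : ∀ {v xs x y} → v ∉ xs → Adj v x → Joined xs x y → Joined (v ∷ xs) v y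
  joined-cons v∉xs e (p , path , uniq , p⊆xs) =
    _ , step e path , ¬Any⇒All¬ p (v∉xs ∘ p⊆xs) ∷ uniq
    , λ { (here refl) → here refl ; (there z∈p) → there (p⊆xs z∈p) }

  joined-snoc : ∀ {v xs x y} → v ∉ xs → Adj x v → Joined xs y x → Joined (v ∷ xs) y v
  joined-snoc {v} {xs} v∉xs e (p , path , uniq , p⊆xs) =
    _ , path-snoc path e
    , Unique.++⁺ uniq ([] ∷ []) (λ { (z∈p , here refl) → v∉xs (p⊆xs z∈p) })
    , p∷ʳv⊆
    where
    p∷ʳv⊆ : ∀ {z} → z ∈ p ∷ʳ v → z ∈ v ∷ xs
    p∷ʳv⊆ z∈ with ∈-++⁻ p z∈
    ... | inj₁ z∈p        = there (p⊆xs z∈p)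
    ... | inj₂ (here z≡v) = here z≡v

  -- The invariant of the growth. `degrees` says that there is one edge fewer than vertices, doubled
  -- and free of subtraction. `joined` accepts a path in either orientation, so that paths never
  -- have to be reversed.
  record Subtree (xs : List (Fin n)) : Set where
    field
      root    : Fin n
      root∈   : root ∈ xs
      unique  : Unique xs
      joined  : ∀ {x y} → x ∈ xs → y ∈ xs → Joined xs x y ⊎ Joined xs y x
      degrees : within xs + 2 ≡ 2 * length xs

  Unique-resp-↭ : ∀ {xs ys : List (Fin n)} → xs ↭ ys → Unique xs → Unique ys
  Unique-resp-↭ p = Permₛ.Unique-resp-↭ (setoid _) (↭⇒↭ₛ p)

  -- Follow the walk to its first vertex outside `xs`; as `xs ++ ys` covers all vertices, that
  -- vertex is in `ys`.
  crossing-edge : ∀ {xs ys u y} → (∀ v → v ∈ xs ++ ys) → Star Adj u y → u ∈ xs → y ∉ xs →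
                  ∃[ x ] ∃[ v ] x ∈ xs × v ∈ ys × Adj x v
  crossing-edge all ε u∈xs y∉xs = contradiction u∈xs y∉xs
  crossing-edge {xs} all (_◅_ {j = w} e walk) u∈xs y∉xs with ∈-++⁻ xs (all w)
  ... | inj₁ w∈xs = crossing-edge all walk w∈xs y∉xs
  ... | inj₂ w∈ys = _ , w , u∈xs , w∈ys , e

  module _ (acyclic : Acyclic G) where

    -- A second edge from v to xs would close a cycle through the path joining its ends.
    subtree-∷ : ∀ {xs x v} → Subtree xs → x ∈ xs → v ∉ xs → Adj x v →
                Subtree (v ∷ xs)
    subtree-∷ {xs} {x} {v} S x∈xs v∉xs e = record
      { root    = root
      ; root∈   = there root∈
      ; unique  = ¬Any⇒All¬ xs v∉xs ∷ unique
      ; joined  = joined′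
      ; degrees = begin
          within (v ∷ xs) + 2                   ≡⟨ cong (_+ 2) (within-∷ v xs) ⟩
          row v xs + row v xs + within xs + 2   ≡⟨ cong (λ t → t + t + within xs + 2)
                                                     (row-one unique x∈xs (symm e) only) ⟩
          2 + (within xs + 2)                   ≡⟨ cong (2 +_) degrees ⟩
          2 + 2 * length xs                     ≡⟨ *-suc 2 (length xs) ⟨
          2 * length (v ∷ xs)                   ∎
      }
      where
      open Subtree S
      open ≡-Reasoning

      only : ∀ {y} → y ∈ xs → y ≢ x → ¬ Adj v y
      only y∈xs y≢x e′ with joined x∈xs y∈xs
      ... | inj₁ J = let (p , cycle) = joined-cycle v∉xs (y≢x ∘ sym) (symm e) e′ J
                     in acyclic v p cycle
      ... | inj₂ J = let (p , cycle) = joined-cycle v∉xs y≢x e′ (symm e) J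
                     in acyclic v p cycle

      joined-v : ∀ {y} → y ∈ xs → Joined (v ∷ xs) v y ⊎ Joined (v ∷ xs) y v
      joined-v y∈xs with joined x∈xs y∈xs
      ... | inj₁ J = inj₁ (joined-cons v∉xs (symm e) J)
      ... | inj₂ J = inj₂ (joined-snoc v∉xs e J)

      joined′ : ∀ {y z} → y ∈ v ∷ xs → z ∈ v ∷ xs →
                Joined (v ∷ xs) y z ⊎ Joined (v ∷ xs) z y
      joined′ (here refl)  (here refl)  = inj₁ joined-refl
      joined′ (here refl)  (there z∈xs) = joined-v z∈xs
      joined′ (there y∈xs) (here refl)  with joined-v y∈xs
      ... | inj₁ J = inj₂ J
      ... | inj₂ J = inj₁ J
      joined′ (there y∈xs) (there z∈xs) with joined y∈xs z∈xs
      ... | inj₁ J = inj₁ (joined-weaken J)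
      ... | inj₂ J = inj₂ (joined-weaken J)

    module _ (connected : Connected G) where

      -- Induction on the number `m` of vertices outside the subtree. The walk from the root to any
      -- of them leaves `xs` along an edge, whose far end is absorbed next.
      grow : ∀ m xs ys → length ys ≡ m → xs ++ ys ↭ allFin n → Subtree xs →
             within (allFin n) + 2 ≡ 2 * n
      grow m xs [] _ xs↭ S = begin
        within (allFin n) + 2  ≡⟨ cong (_+ 2) (within-↭ xs↭allFin) ⟨
        within xs + 2          ≡⟨ Subtree.degrees S ⟩
        2 * length xs          ≡⟨ cong (2 *_) (↭-length xs↭allFin) ⟩
        2 * length (allFin n)  ≡⟨ cong (2 *_) (List.length-tabulate {n = n} (λ i → i)) ⟩
        2 * n                  ∎
        where
        open ≡-Reasoning
        xs↭allFin : xs ↭ allFin n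
        xs↭allFin = subst (_↭ allFin n) (List.++-identityʳ xs) xs↭
      grow (suc m) xs ys@(y ∷ ys′) len xs↭ S
        with crossing-edge (λ v → ∈-resp-↭ (↭-sym xs↭) (∈-allFin v))
               (connected (Subtree.root S) y) (Subtree.root∈ S) y∉xs
        where
        y∉xs : y ∉ xs
        y∉xs y∈xs with Unique-resp-↭ (↭-trans (↭-sym xs↭) (shift y xs ys′)) (Unique.allFin⁺ n)
        ... | y∉ ∷ _ = All.lookup y∉ (∈-++⁺ˡ y∈xs) refl
      ... | x , v , x∈xs , v∈ys , e with ∈-∃++ v∈ys
      ... | ls , rs , eq = grow m (v ∷ xs) (ls ++ rs)
              (suc-injective (trans (sym (↭-length ys↭)) len))
              (↭-trans (↭-sym move) xs↭)
              (subtree-∷ S x∈xs v∉xs e)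
        where
        ys↭ : ys ↭ v ∷ ls ++ rs
        ys↭ = ↭-trans (↭-reflexive eq) (shift v ls rs)
        move : xs ++ ys ↭ v ∷ xs ++ ls ++ rs
        move = ↭-trans (++⁺ˡ xs ys↭) (shift v xs (ls ++ rs))
        uniq : Unique (v ∷ xs ++ ls ++ rs)
        uniq = Unique-resp-↭ (↭-trans (↭-sym xs↭) move) (Unique.allFin⁺ n)
        v∉xs : v ∉ xs
        v∉xs v∈xs with uniq
        ... | v∉ ∷ _ = All.lookup v∉ (∈-++⁺ˡ v∈xs) refl

  sum-degrees : IsTree G → sum (degree G) + 2 ≡ 2 * n
  sum-degrees (0<n , connected , acyclic) = trans (cong (_+ 2) (sym within-all)) (start n refl 0<n)
    where
    within-all : within (allFin n) ≡ sum (degree G)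
    within-all = trans (sum-allFin (λ u → row u (allFin n)))
      (sum-cong-≗ λ u → sum-allFin (adj u))
    -- Matching on `l` exposes a first vertex, which alone forms a subtree: 0 + 2 = 2 * 1.
    start : ∀ l → n ≡ l → 0 < l → within (allFin n) + 2 ≡ 2 * n
    start (suc l) refl _ = grow acyclic connected l (zero ∷ []) _ (List.length-tabulate {n = l} suc)
      ↭-refl (record
        { root    = zero
        ; root∈   = here refl
        ; unique  = [] ∷ []
        ; joined  = λ { (here refl) (here refl) → inj₁ joined-refl }
        ; degrees = cong (λ t → t + 0 + 0 + 2) (adj-false irrefl) })

-- Edge types and the identities valid for a single edge.

δ : ℕ → ℕ → ℕ
δ i j = if does (i ≟ j) then 1 else 0

-- The summand of m in Defs.
pair : (i j x y : ℕ) → ℕ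
pair i j x y = if does ((x ≟ i ×-dec y ≟ j) ⊎-dec (x ≟ j ×-dec y ≟ i)) then 1 else 0

pair-comm : ∀ i j x y → pair i j x y ≡ pair i j y x
pair-comm i j x y = cong (if_then 1 else 0) (trans
  (∨-comm (does (x ≟ i) ∧ does (y ≟ j)) (does (x ≟ j) ∧ does (y ≟ i)))
  (cong₂ _∨_ (∧-comm (does (x ≟ j)) (does (y ≟ i))) (∧-comm (does (x ≟ i)) (does (y ≟ j)))))

δ-refl : ∀ i → δ i i ≡ 1
δ-refl i = cong (if_then 1 else 0) (dec-true (i ≟ i) refl)

δ-≢ : ∀ {i j} → i ≢ j → δ i j ≡ 0
δ-≢ {i} {j} i≢j = cong (if_then 1 else 0) (dec-false (i ≟ j) i≢j)

Allowed : (Δ a x : ℕ) → Set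
Allowed Δ a x = x ≡ 1 ⊎ x ≡ 2 ⊎ x ≡ a ⊎ x ≡ Δ

data EdgeType (Δ a : ℕ) : ℕ → ℕ → Set where
  type1Δ : EdgeType Δ a 1 Δ
  type22 : EdgeType Δ a 2 2
  type2a : EdgeType Δ a 2 a
  type2Δ : EdgeType Δ a 2 Δ
  typeaΔ : EdgeType Δ a a Δ
  typeΔΔ : EdgeType Δ a Δ Δ

-- `does (x ≟ y)` computes to `x ≡ᵇ y`. With `a = 3 + i` and `Δ = suc (a + e)`, comparisons with 1
-- and 2 evaluate, and once common successors are stripped the remaining ones are covered by this
-- lemma and the next two.
≡ᵇ-refl : ∀ i → (i ≡ᵇ i) ≡ true
≡ᵇ-refl i = dec-true (i ≟ i) refl

≡ᵇ-suc : ∀ i e → (i ≡ᵇ suc (i + e)) ≡ false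
≡ᵇ-suc i e = dec-false (i ≟ suc (i + e)) (m≢1+m+n i)

suc-≡ᵇ : ∀ i e → (suc (i + e) ≡ᵇ i) ≡ false
suc-≡ᵇ i e = dec-false (suc (i + e) ≟ i) (m≢1+m+n i ∘ sym)

-- Counts the ends of degree 1 or 2: one per edge, except two at a 22 edge and none at an aΔ or ΔΔ
-- edge.
EdgeCount : (Δ a x y : ℕ) → Set
EdgeCount Δ a x y =
  1 + pair 2 2 x y ≡ δ x 1 + δ y 1 + (δ x 2 + δ y 2) + pair a Δ x y + pair Δ Δ x y

-- Each end of degree 1 or 2 is charged as if the other end had degree Δ. A 22 edge is thus charged
-- 2(Δ - 2)² instead of 0, and a 2a edge (Δ - 2)² instead of (a - 2)²; an aΔ edge has no charged end
-- and enters with its own weight.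
EdgeWeight : (Δ a x y : ℕ) → Set
EdgeWeight Δ a x y =
  ∣ x - y ∣ ^ 2 + ∣ 2 - Δ ∣ ^ 2 * (2 * pair 2 2 x y + pair a 2 x y) ≡
  ∣ 1 - Δ ∣ ^ 2 * (δ x 1 + δ y 1) + ∣ 2 - Δ ∣ ^ 2 * (δ x 2 + δ y 2)
    + ∣ 2 - a ∣ ^ 2 * pair a 2 x y + ∣ a - Δ ∣ ^ 2 * pair a Δ x y

edgeCount-comm : ∀ Δ a x y → EdgeCount Δ a x y → EdgeCount Δ a y x
edgeCount-comm Δ a x y h
  rewrite pair-comm 2 2 y x | pair-comm a Δ y x | pair-comm Δ Δ y x
        | +-comm (δ y 1) (δ x 1) | +-comm (δ y 2) (δ x 2) = h

edgeWeight-comm : ∀ Δ a x y → EdgeWeight Δ a x y → EdgeWeight Δ a y x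
edgeWeight-comm Δ a x y h
  rewrite pair-comm 2 2 y x | pair-comm a Δ y x | pair-comm a 2 y x | ∣-∣-comm y x
        | +-comm (δ y 1) (δ x 1) | +-comm (δ y 2) (δ x 2) = h

edgeCount : ∀ i e {x y} → let a = 3 + i; Δ = suc (a + e) in
            EdgeType Δ a x y → EdgeCount Δ a x y
edgeCount i e type1Δ = refl
edgeCount i e type22 = refl
edgeCount i e type2a = refl
edgeCount i e type2Δ = refl
edgeCount i e typeaΔ rewrite ≡ᵇ-refl (i + e) | ≡ᵇ-refl i | ≡ᵇ-suc i e = refl
edgeCount i e typeΔΔ rewrite ≡ᵇ-refl (i + e) | suc-≡ᵇ i e = refl

edgeWeight : ∀ i e {x y} → let a = 3 + i; Δ = suc (a + e) in
             EdgeType Δ a x y → EdgeWeight Δ a x y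
edgeWeight i e type = weight type
  where
  a = 3 + i
  Δ = suc (a + e)
  p = ∣ 1 - Δ ∣ ^ 2
  q = ∣ 2 - Δ ∣ ^ 2
  t = ∣ 2 - a ∣ ^ 2
  u = ∣ a - Δ ∣ ^ 2

  only-1Δ : ∀ p q t u → p + q * 0 ≡ p * 1 + q * 0 + t * 0 + u * 0
  only-1Δ = solve-∀
  only-22 : ∀ p q t u → 0 + q * 2 ≡ p * 0 + q * 2 + t * 0 + u * 0
  only-22 = solve-∀
  only-2a : ∀ p q t u → t + q * 1 ≡ p * 0 + q * 1 + t * 1 + u * 0
  only-2a = solve-∀
  only-2Δ : ∀ p q t u → q + q * 0 ≡ p * 0 + q * 1 + t * 0 + u * 0
  only-2Δ = solve-∀
  only-aΔ : ∀ p q t u → u + q * 0 ≡ p * 0 + q * 0 + t * 0 + u * 1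
  only-aΔ = solve-∀
  only-ΔΔ : ∀ p q t u → 0 + q * 0 ≡ p * 0 + q * 0 + t * 0 + u * 0
  only-ΔΔ = solve-∀

  weight : ∀ {x y} → EdgeType Δ a x y → EdgeWeight Δ a x y
  weight type1Δ = only-1Δ p q t u
  weight type22 = only-22 p q t u
  weight type2a rewrite ≡ᵇ-refl i = only-2a p q t u
  weight type2Δ rewrite suc-≡ᵇ i e = only-2Δ p q t u
  weight typeaΔ rewrite ≡ᵇ-refl (i + e) | ≡ᵇ-refl i = only-aΔ p q t u
  weight typeΔΔ rewrite ≡ᵇ-refl (i + e) | suc-≡ᵇ i e | ∣n-n∣≡0 (i + e) = only-ΔΔ p q t u

*-δ : ∀ x i → x * δ x i ≡ i * δ x i
*-δ x i with x ≟ i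
... | yes refl = refl
... | no  x≢i rewrite δ-≢ x≢i = trans (*-zeroʳ x) (sym (*-zeroʳ i))

∑-distrib-+₄ : ∀ {n} (f g h k : Fin n → ℕ) →
  sum (λ i → f i + g i + h i + k i) ≡ sum f + sum g + sum h + sum k
∑-distrib-+₄ f g h k = trans (∑-distrib-+ (λ i → f i + g i + h i) k) (cong (_+ sum k)
  (trans (∑-distrib-+ (λ i → f i + g i) h) (cong (_+ sum h) (∑-distrib-+ f g))))

sum-ones : ∀ n → sum {n} (λ _ → 1) ≡ n
sum-ones zero    = refl
sum-ones (suc n) = cong suc (sum-ones n)

-- Double counting over ordered adjacent pairs.

module _ {n : ℕ} (G : Graph n) where
  open Graph G

  -- Each edge is visited in both directions, so a summand depending on one end only becomes a sum
  -- over vertices weighted by degree. The price is a factor 2 against `∑ₑ`.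
  ∑² : (Fin n → Fin n → ℕ) → ℕ
  ∑² f = sum λ u → sum λ v → adj G u v * f u v

  ∑²-cong : ∀ {f g} → (∀ {u v} → Adj u v → f u v ≡ g u v) → ∑² f ≡ ∑² g
  ∑²-cong {f} {g} eq = sum-cong-≗ λ u → sum-cong-≗ λ v → pointwise u v
    where
    pointwise : ∀ u v → adj G u v * f u v ≡ adj G u v * g u v
    pointwise u v with adj? u v
    ... | yes e = cong (1 *_) (eq e)
    ... | no  _ = refl

  ∑²-+ : ∀ f g → ∑² (λ u v → f u v + g u v) ≡ ∑² f + ∑² g
  ∑²-+ f g = trans
    (sum-cong-≗ λ u → trans
      (sum-cong-≗ λ v → *-distribˡ-+ (adj G u v) (f u v) (g u v))
      (∑-distrib-+ (λ v → adj G u v * f u v) (λ v → adj G u v * g u v)))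
    (∑-distrib-+ (λ u → sum λ v → adj G u v * f u v) (λ u → sum λ v → adj G u v * g u v))

  ∑²-* : ∀ c f → ∑² (λ u v → c * f u v) ≡ c * ∑² f
  ∑²-* c f = trans
    (sum-cong-≗ λ u → trans
      (sum-cong-≗ λ v → swap (adj G u v) c (f u v))
      (sym (*-distribˡ-sum c (λ v → adj G u v * f u v))))
    (sym (*-distribˡ-sum c (λ u → sum λ v → adj G u v * f u v)))
    where
    swap : ∀ x y z → x * (y * z) ≡ y * (x * z)
    swap = solve-∀

  ∑²-flip : ∀ f → ∑² (λ u v → f v u) ≡ ∑² f
  ∑²-flip f = trans (∑-comm (λ u v → adj G u v * f v u))
    (sum-cong-≗ λ v → sum-cong-≗ λ u → cong (_* f v u) (adj-comm G u v))

  ∑²-degree : ∀ (g : Fin n → ℕ) → ∑² (λ u _ → g u) ≡ sum λ u → degree G u * g u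
  ∑²-degree g = sum-cong-≗ λ u → begin
    sum (λ v → adj G u v * g u)  ≡⟨ sum-cong-≗ (λ v → *-comm (adj G u v) (g u)) ⟩
    sum (λ v → g u * adj G u v)  ≡⟨ *-distribˡ-sum (g u) (adj G u) ⟨
    g u * degree G u             ≡⟨ *-comm (g u) _ ⟩
    degree G u * g u             ∎
    where open ≡-Reasoning

  -- A vertex of degree `i` is the first entry of exactly `i` adjacent pairs.
  ∑²-δ : ∀ i → ∑² (λ u _ → δ (degree G u) i) ≡ i * #deg G i
  ∑²-δ i = trans (∑²-degree (λ u → δ (degree G u) i))
    (trans (sum-cong-≗ λ u → *-δ (degree G u) i)
           (sym (*-distribˡ-sum i (λ u → δ (degree G u) i))))

  ∑²-δ² : ∀ i → ∑² (λ u v → δ (degree G u) i + δ (degree G v) i) ≡ 2 * (i * #deg G i)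
  ∑²-δ² i = begin
    ∑² (λ u v → δ (degree G u) i + δ (degree G v) i)
      ≡⟨ ∑²-+ (λ u _ → δ (degree G u) i) (λ _ v → δ (degree G v) i) ⟩
    ∑² (λ u _ → δ (degree G u) i) + ∑² (λ _ v → δ (degree G v) i)
      ≡⟨ cong (∑² (λ u _ → δ (degree G u) i) +_) (∑²-flip (λ u _ → δ (degree G u) i)) ⟩
    ∑² (λ u _ → δ (degree G u) i) + ∑² (λ u _ → δ (degree G u) i)
      ≡⟨ cong₂ _+_ (∑²-δ i) (trans (∑²-δ i) (sym (+-identityʳ _))) ⟩
    2 * (i * #deg G i) ∎
    where open ≡-Reasoning

  -- The pairs split by the order of `u` and `v`. The diagonal vanishes by irreflexivity, and
  -- symmetry of `f` identifies the two halves.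
  handshake : ∀ {f} → (∀ u v → f u v ≡ f v u) → ∑² f ≡ 2 * ∑ₑ G f
  handshake {f} f-comm = begin
    ∑² f
      ≡⟨ sum-cong-≗ (λ u → sum-cong-≗ (λ v → split u v)) ⟩
    sum (λ u → sum λ v → h u v + h v u)
      ≡⟨ sum-cong-≗ (λ u → ∑-distrib-+ (h u) (λ v → h v u)) ⟩
    sum (λ u → sum (h u) + sum (λ v → h v u))
      ≡⟨ ∑-distrib-+ (λ u → sum (h u)) (λ u → sum (λ v → h v u)) ⟩
    ∑ₑ G f + sum (λ u → sum λ v → h v u)
      ≡⟨ cong (∑ₑ G f +_) (trans (∑-comm (λ u v → h v u)) (sym (+-identityʳ _))) ⟩
    2 * ∑ₑ G f ∎
    where
    open ≡-Reasoning
    h : Fin n → Fin n → ℕ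
    h u v = if does (u Fin.<? v ×-dec adj? u v) then f u v else 0

    h-< : ∀ {u v} → u Fin.< v → h u v ≡ adj G u v * f u v
    h-< {u} {v} u<v rewrite dec-true (u Fin.<? v) u<v with does (adj? u v)
    ... | true  = sym (*-identityˡ (f u v))
    ... | false = refl

    h-≮ : ∀ {u v} → ¬ u Fin.< v → h u v ≡ 0
    h-≮ {u} {v} u≮v rewrite dec-false (u Fin.<? v) u≮v = refl

    split : ∀ u v → adj G u v * f u v ≡ h u v + h v u
    split u v with Fin.<-cmp u v
    ... | tri< u<v _ v≮u rewrite h-< u<v | h-≮ v≮u = sym (+-identityʳ _)
    ... | tri≈ u≮u refl _ rewrite h-≮ u≮u | adj-false G {u} irrefl = refl
    ... | tri> u≮v _ v<u rewrite h-≮ u≮v | h-< v<u =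
      cong₂ _*_ (adj-comm G u v) (f-comm u v)

  ∑²-pair : ∀ i j → ∑² (λ u v → pair i j (degree G u) (degree G v)) ≡ 2 * m G i j
  ∑²-pair i j = handshake λ u v → pair-comm i j (degree G u) (degree G v)

  module _ {Δ a : ℕ}
    (3≤a : 3 ≤ a) (a<Δ : a < Δ)
    (degrees : ∀ v → Allowed Δ a (degree G v))
    where

    δ-partition : ∀ v → let x = degree G v in 1 ≡ δ x 1 + δ x 2 + δ x a + δ x Δ
    δ-partition v = partition (degrees v)
      where
      partition : ∀ {x} → Allowed Δ a x → 1 ≡ δ x 1 + δ x 2 + δ x a + δ x Δ
      partition type with m≤n⇒∃[o]m+o≡n 3≤a | m≤n⇒∃[o]m+o≡n a<Δ
      ... | i , refl | e , refl with type
      ...   | inj₁ refl               = refl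
      ...   | inj₂ (inj₁ refl)        = refl
      ...   | inj₂ (inj₂ (inj₁ refl)) rewrite ≡ᵇ-refl i | ≡ᵇ-suc i e = refl
      ...   | inj₂ (inj₂ (inj₂ refl)) rewrite suc-≡ᵇ i e | ≡ᵇ-refl (i + e) = refl

    vertex-count : n ≡ #deg G 1 + #deg G 2 + #deg G a + #deg G Δ
    vertex-count = trans (sym (sum-ones n)) (trans (sum-cong-≗ δ-partition)
      (∑-distrib-+₄ (λ v → δ (degree G v) 1) (λ v → δ (degree G v) 2)
                    (λ v → δ (degree G v) a) (λ v → δ (degree G v) Δ)))

    degree-sum : sum (degree G) ≡ 1 * #deg G 1 + 2 * #deg G 2 + a * #deg G a + Δ * #deg G Δ
    degree-sum = begin
      sum (degree G)
        ≡⟨ sum-cong-≗ pointwise ⟩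
      sum (λ v → term 1 v + term 2 v + term a v + term Δ v)
        ≡⟨ ∑-distrib-+₄ (term 1) (term 2) (term a) (term Δ) ⟩
      sum (term 1) + sum (term 2) + sum (term a) + sum (term Δ)
        ≡⟨ cong₂ _+_ (cong₂ _+_ (cong₂ _+_ (total 1) (total 2)) (total a)) (total Δ) ⟩
      1 * #deg G 1 + 2 * #deg G 2 + a * #deg G a + Δ * #deg G Δ ∎
      where
      open ≡-Reasoning
      term : ℕ → Fin n → ℕ
      term i v = i * δ (degree G v) i

      total : ∀ i → sum (term i) ≡ i * #deg G i
      total i = sym (*-distribˡ-sum i (λ v → δ (degree G v) i))

      distrib : ∀ x p q r s → x * (p + q + r + s) ≡ x * p + x * q + x * r + x * s
      distrib = solve-∀

      pointwise : ∀ v → degree G v ≡ term 1 v + term 2 v + term a v + term Δ v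
      pointwise v = let x = degree G v in
        trans (sym (*-identityʳ x)) (trans (cong (x *_) (δ-partition v))
          (trans (distrib x (δ x 1) (δ x 2) (δ x a) (δ x Δ))
            (cong₂ _+_ (cong₂ _+_ (cong₂ _+_ (*-δ x 1) (*-δ x 2)) (*-δ x a)) (*-δ x Δ))))

  module _ {Δ a : ℕ}
    (3≤a : 3 ≤ a) (a<Δ : a < Δ)
    (edges : ∀ {u v} → Adj u v → EdgeType Δ a (degree G u) (degree G v)
                               ⊎ EdgeType Δ a (degree G v) (degree G u))
    where
    open ≡-Reasoning

    private
      deg = degree G
      p₂₂ pₐ₂ pₐΔ pΔΔ : Fin n → Fin n → ℕ
      p₂₂ u v = pair 2 2 (deg u) (deg v)
      pₐ₂ u v = pair a 2 (deg u) (deg v)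
      pₐΔ u v = pair a Δ (deg u) (deg v)
      pΔΔ u v = pair Δ Δ (deg u) (deg v)
      δ₁ δ₂ : Fin n → Fin n → ℕ
      δ₁ u v = δ (deg u) 1 + δ (deg v) 1
      δ₂ u v = δ (deg u) 2 + δ (deg v) 2

    -- `EdgeCount` summed over all ordered adjacent pairs, where its constant 1 adds up to the
    -- degree sum.
    edge-count : sum deg + 2 * m G 2 2 ≡
                 2 * (1 * #deg G 1) + 2 * (2 * #deg G 2) + 2 * m G a Δ + 2 * m G Δ Δ
    edge-count = begin
      sum deg + 2 * m G 2 2
        ≡⟨ cong₂ _+_ (trans (sum-cong-≗ λ u → sym (*-identityʳ (deg u)))
                            (sym (∑²-degree λ _ → 1)))
                     (sym (∑²-pair 2 2)) ⟩
      ∑² (λ _ _ → 1) + ∑² p₂₂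
        ≡⟨ ∑²-+ (λ _ _ → 1) p₂₂ ⟨
      ∑² (λ u v → 1 + p₂₂ u v)
        ≡⟨ ∑²-cong balance ⟩
      ∑² (λ u v → δ₁ u v + δ₂ u v + pₐΔ u v + pΔΔ u v)
        ≡⟨ trans (∑²-+ (λ u v → δ₁ u v + δ₂ u v + pₐΔ u v) pΔΔ) (cong (_+ ∑² pΔΔ)
             (trans (∑²-+ (λ u v → δ₁ u v + δ₂ u v) pₐΔ) (cong (_+ ∑² pₐΔ) (∑²-+ δ₁ δ₂)))) ⟩
      ∑² δ₁ + ∑² δ₂ + ∑² pₐΔ + ∑² pΔΔ
        ≡⟨ cong₂ _+_ (cong₂ _+_ (cong₂ _+_ (∑²-δ² 1) (∑²-δ² 2)) (∑²-pair a Δ)) (∑²-pair Δ Δ) ⟩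
      2 * (1 * #deg G 1) + 2 * (2 * #deg G 2) + 2 * m G a Δ + 2 * m G Δ Δ ∎
      where
      balance : ∀ {u v} → Adj u v → EdgeCount Δ a (deg u) (deg v)
      balance {u} {v} e with m≤n⇒∃[o]m+o≡n 3≤a | m≤n⇒∃[o]m+o≡n a<Δ | edges e
      ... | i , refl | o , refl | inj₁ type = edgeCount i o type
      ... | i , refl | o , refl | inj₂ type = edgeCount-comm Δ a (deg v) (deg u) (edgeCount i o type)

    edge-weight : let p = ∣ 1 - Δ ∣ ^ 2; q = ∣ 2 - Δ ∣ ^ 2; t = ∣ 2 - a ∣ ^ 2; u = ∣ a - Δ ∣ ^ 2 in
      2 * σ G + q * (2 * (2 * m G 2 2) + 2 * m G a 2) ≡
      p * (2 * (1 * #deg G 1)) + q * (2 * (2 * #deg G 2)) + t * (2 * m G a 2) + u * (2 * m G a Δ)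
    edge-weight = begin
      2 * σ G + q * (2 * (2 * m G 2 2) + 2 * m G a 2)
        ≡⟨ cong₂ _+_ (handshake (λ u v → cong (_^ 2) (∣-∣-comm (deg u) (deg v))))
             (cong (q *_) (cong₂ _+_ (cong (2 *_) (∑²-pair 2 2)) (∑²-pair a 2))) ⟨
      ∑² w + q * (2 * ∑² p₂₂ + ∑² pₐ₂)
        ≡⟨ trans (∑²-+ w (λ u v → q * (2 * p₂₂ u v + pₐ₂ u v))) (cong (∑² w +_)
             (trans (∑²-* q (λ u v → 2 * p₂₂ u v + pₐ₂ u v)) (cong (q *_)
               (trans (∑²-+ (λ u v → 2 * p₂₂ u v) pₐ₂) (cong (_+ ∑² pₐ₂) (∑²-* 2 p₂₂)))))) ⟨
      ∑² (λ u v → w u v + q * (2 * p₂₂ u v + pₐ₂ u v))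
        ≡⟨ ∑²-cong balance ⟩
      ∑² (λ u v → p * δ₁ u v + q * δ₂ u v + t * pₐ₂ u v + s * pₐΔ u v)
        ≡⟨ trans (∑²-+ (λ u v → p * δ₁ u v + q * δ₂ u v + t * pₐ₂ u v) (λ u v → s * pₐΔ u v))
             (cong₂ _+_ (trans (∑²-+ (λ u v → p * δ₁ u v + q * δ₂ u v) (λ u v → t * pₐ₂ u v))
               (cong₂ _+_ (trans (∑²-+ (λ u v → p * δ₁ u v) (λ u v → q * δ₂ u v))
                 (cong₂ _+_ (∑²-* p δ₁) (∑²-* q δ₂))) (∑²-* t pₐ₂))) (∑²-* s pₐΔ)) ⟩
      p * ∑² δ₁ + q * ∑² δ₂ + t * ∑² pₐ₂ + s * ∑² pₐΔ
        ≡⟨ cong₂ _+_ (cong₂ _+_ (cong₂ _+_ (cong (p *_) (∑²-δ² 1)) (cong (q *_) (∑²-δ² 2)))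
             (cong (t *_) (∑²-pair a 2))) (cong (s *_) (∑²-pair a Δ)) ⟩
      p * (2 * (1 * #deg G 1)) + q * (2 * (2 * #deg G 2)) + t * (2 * m G a 2) + s * (2 * m G a Δ) ∎
      where
      p = ∣ 1 - Δ ∣ ^ 2
      q = ∣ 2 - Δ ∣ ^ 2
      t = ∣ 2 - a ∣ ^ 2
      s = ∣ a - Δ ∣ ^ 2
      w : Fin n → Fin n → ℕ
      w u v = ∣ deg u - deg v ∣ ^ 2

      balance : ∀ {u v} → Adj u v → EdgeWeight Δ a (deg u) (deg v)
      balance {u} {v} e with m≤n⇒∃[o]m+o≡n 3≤a | m≤n⇒∃[o]m+o≡n a<Δ | edges e
      ... | i , refl | o , refl | inj₁ type = edgeWeight i o type
      ... | i , refl | o , refl | inj₂ type = edgeWeight-comm Δ a (deg v) (deg u) (edgeWeight i o type)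

-- Neighbours of leaves and the edge types that can occur.

sum-mono-< : ∀ {n} {f g : Fin n → ℕ} → (∀ i → f i ≤ g i) → ∀ i → f i < g i → sum f < sum g
sum-mono-< f≤g zero    f<g = +-mono-<-≤ f<g (sum-mono (f≤g ∘ suc))
sum-mono-< f≤g (suc i) f<g = +-mono-≤-< (f≤g zero) (sum-mono-< (f≤g ∘ suc) i f<g)

module _ {n : ℕ} (G : Graph n) where
  open Graph G

  private
    deg = degree G

  nbr : {P : Pred ℕ 0ℓ} → Decidable P → Fin n → Fin n → ℕ
  nbr P? v u = if does (adj? v u ×-dec P? (deg u)) then 1 else 0

  nbr≤adj : {P : Pred ℕ 0ℓ} (P? : Decidable P) → ∀ v u → nbr P? v u ≤ adj G v u
  nbr≤adj P? v u with does (adj? v u) | does (P? (deg u))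
  ... | true  | true  = ≤-refl
  ... | true  | false = z≤n
  ... | false | _     = z≤n

  nbr-true : {P : Pred ℕ 0ℓ} (P? : Decidable P) → ∀ {v u} → Adj v u → P (deg u) → nbr P? v u ≡ 1
  nbr-true P? {v} {u} e Pu =
    cong (if_then 1 else 0) (dec-true (adj? v u ×-dec P? (deg u)) (e , Pu))

  nbr-false : {P : Pred ℕ 0ℓ} (P? : Decidable P) → ∀ {v u} → ¬ P (deg u) → nbr P? v u ≡ 0
  nbr-false P? {v} {u} ¬Pu =
    cong (if_then 1 else 0) (dec-false (adj? v u ×-dec P? (deg u)) (¬Pu ∘ proj₂))

  nbr-δ : ∀ i v u → nbr (_≟ i) v u ≡ adj G v u * δ (deg u) i
  nbr-δ i v u with does (adj? v u)
  ... | true  = sym (*-identityˡ (δ (deg u) i))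
  ... | false = refl

  adj⇒deg≥1 : ∀ {u v} → Adj u v → 1 ≤ deg u
  adj⇒deg≥1 {u} {v} e = subst (_≤ deg u) (adj-true G e) (term≤sum (adj G u) v)

  leaf-neighbour-unique : ∀ {x y v} → deg x ≤ 1 → Adj x v → Adj x y → y ≡ v
  leaf-neighbour-unique {x} {y} {v} dx≤1 e e′ with y Fin.≟ v
  ... | yes y≡v = y≡v
  ... | no  y≢v = contradiction
    (≤-trans (subst (_≤ deg x) (cong₂ _+_ (adj-true G e′) (adj-true G e))
                (two-terms≤sum (adj G x) y≢v)) dx≤1)
    (<⇒≱ (s≤s (s≤s z≤n)))

  module Leaves {Δ : ℕ} (2<Δ : 2 < Δ) (tree : IsTree G) (maxDegree : HasMaxDegree G Δ)
                (internalLeaves : InternalLeavesHaveDegree G Δ) where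

    private
      connected = proj₁ (proj₂ tree)
      top = proj₁ (proj₂ maxDegree)
      deg-top = proj₂ (proj₂ maxDegree)

    deg≥1 : ∀ v → 1 ≤ deg v
    deg≥1 v with connected v top
    ... | ε     = subst (1 ≤_) (sym deg-top) (≤-trans (s≤s z≤n) 2<Δ)
    ... | e ◅ _ = adj⇒deg≥1 e

    -- If all neighbours of v were leaves, the tree would be a star centred at v.
    heavy-neighbour : ∀ v → deg v < Δ → #neighbours G (1 <?_) v ≢ 0
    heavy-neighbour v dv<Δ none = walk (inj₁ refl) (connected v top)
      where
      light : ∀ {u} → Adj v u → deg u ≤ 1
      light {u} e with 1 <? deg u
      ... | no  1≮du = ≮⇒≥ 1≮du
      ... | yes 1<du = contradiction
        (trans (sym (sum≡0⇒term≡0 (nbr (1 <?_) v) none u)) (nbr-true (1 <?_) e 1<du)) λ ()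

      walk : ∀ {x} → x ≡ v ⊎ Adj v x → ¬ Star Adj x top
      walk (inj₁ refl) ε = <⇒≢ dv<Δ deg-top
      walk (inj₂ e)    ε = <⇒≱ (≤-trans (s≤s (s≤s z≤n)) 2<Δ) (subst (_≤ 1) deg-top (light e))
      walk (inj₁ refl) (e′ ◅ w) = walk (inj₂ e′) w
      walk (inj₂ e)    (e′ ◅ w) = walk (inj₁ (leaf-neighbour-unique (light e) (symm e) e′)) w

    -- If `deg v ≤ 2`, then apart from the leaf `u` there is room for at most one neighbour, and by
    -- `heavy-neighbour` some neighbour is not a leaf. Then `v` is an internal leaf of degree below
    -- Δ.
    leaf-neighbour : ∀ {u v} → Adj u v → deg u ≡ 1 → 3 ≤ deg v
    leaf-neighbour {u} {v} e du≡1 with 3 ≤? deg v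
    ... | yes 3≤dv = 3≤dv
    ... | no  3≰dv = contradiction (internalLeaves v (dv≥2 , one)) (<⇒≢ dv<Δ)
      where
      dv≤2 : deg v ≤ 2
      dv≤2 = s≤s⁻¹ (≰⇒> 3≰dv)
      dv<Δ : deg v < Δ
      dv<Δ = ≤-<-trans dv≤2 2<Δ
      heavy = #neighbours G (1 <?_) v
      heavy<dv : heavy < deg v
      heavy<dv = sum-mono-< (nbr≤adj (1 <?_) v) u
        (subst₂ _<_ (sym (nbr-false (1 <?_) (<-irrefl (sym du≡1)))) (sym (adj-true G (symm e)))
          (s≤s z≤n))
      0<heavy : 0 < heavy
      0<heavy = n≢0⇒n>0 (heavy-neighbour v dv<Δ)
      dv≥2 : 2 ≤ deg v
      dv≥2 = ≤-trans (s≤s 0<heavy) heavy<dv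
      one : heavy ≡ 1
      one = ≤-antisym (s≤s⁻¹ (≤-trans heavy<dv dv≤2)) 0<heavy

    module _ {a : ℕ} (3≤a : 3 ≤ a) (a<Δ : a < Δ)
      (degrees : ∀ v → Allowed Δ a (deg v))
      (medium-neighbour : ∀ {u v} → Adj u v → deg u ≡ a → deg v ≡ 2 ⊎ deg v ≡ Δ) where

      -- Of the allowed degrees only `a` and Δ are at least 3, and a vertex of degree `a` has no
      -- leaf next to it.
      leaf-edge : ∀ {u v} → Adj u v → deg u ≡ 1 → deg v ≡ Δ
      leaf-edge {u} {v} e du≡1 with leaf-neighbour e du≡1 | degrees v
      ... | 3≤dv | inj₁ dv≡1 = contradiction (subst (3 ≤_) dv≡1 3≤dv) λ { (s≤s ()) }
      ... | 3≤dv | inj₂ (inj₁ dv≡2) = contradiction (subst (3 ≤_) dv≡2 3≤dv) λ { (s≤s (s≤s ())) }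
      ... | _    | inj₂ (inj₂ (inj₂ dv≡Δ)) = dv≡Δ
      ... | _    | inj₂ (inj₂ (inj₁ dv≡a)) with medium-neighbour (symm e) dv≡a
      ...   | inj₁ du≡2 with () ← trans (sym du≡1) du≡2
      ...   | inj₂ du≡Δ = contradiction (trans (sym du≡1) du≡Δ) (<⇒≢ (<-trans (s≤s (s≤s z≤n)) 2<Δ))

      edge-type : ∀ {u v} → Adj u v → EdgeType Δ a (deg u) (deg v) ⊎ EdgeType Δ a (deg v) (deg u)
      edge-type {u} {v} e with degrees u | degrees v
      ... | inj₁ du | _ = inj₁ (subst₂ (EdgeType Δ a) (sym du) (sym (leaf-edge e du)) type1Δ)
      ... | _ | inj₁ dv = inj₂ (subst₂ (EdgeType Δ a) (sym dv) (sym (leaf-edge (symm e) dv)) type1Δ)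
      ... | inj₂ (inj₁ du) | inj₂ (inj₁ dv) = inj₁ (subst₂ (EdgeType Δ a) (sym du) (sym dv) type22)
      ... | inj₂ (inj₁ du) | inj₂ (inj₂ (inj₁ dv)) = inj₁ (subst₂ (EdgeType Δ a) (sym du) (sym dv) type2a)
      ... | inj₂ (inj₁ du) | inj₂ (inj₂ (inj₂ dv)) = inj₁ (subst₂ (EdgeType Δ a) (sym du) (sym dv) type2Δ)
      ... | inj₂ (inj₂ (inj₁ du)) | _ with medium-neighbour e du
      ...   | inj₁ dv = inj₂ (subst₂ (EdgeType Δ a) (sym dv) (sym du) type2a)
      ...   | inj₂ dv = inj₁ (subst₂ (EdgeType Δ a) (sym du) (sym dv) typeaΔ)
      edge-type e | inj₂ (inj₂ (inj₂ du)) | inj₂ (inj₁ dv) = inj₂ (subst₂ (EdgeType Δ a) (sym dv) (sym du) type2Δ)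
      edge-type e | inj₂ (inj₂ (inj₂ du)) | inj₂ (inj₂ (inj₁ dv)) = inj₂ (subst₂ (EdgeType Δ a) (sym dv) (sym du) typeaΔ)
      edge-type e | inj₂ (inj₂ (inj₂ du)) | inj₂ (inj₂ (inj₂ dv)) = inj₁ (subst₂ (EdgeType Δ a) (sym du) (sym dv) typeΔΔ)

  pair-≢ : ∀ {i j x y} → ¬ (x ≡ i × y ≡ j) → ¬ (x ≡ j × y ≡ i) → pair i j x y ≡ 0
  pair-≢ {i} {j} {x} {y} ¬p ¬q = cong (if_then 1 else 0)
    (dec-false ((x ≟ i ×-dec y ≟ j) ⊎-dec (x ≟ j ×-dec y ≟ i))
      λ { (inj₁ p) → ¬p p ; (inj₂ q) → ¬q q })

  ∑²-zero : ∑² G (λ _ _ → 0) ≡ 0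
  ∑²-zero = sum-zero _ λ u → sum-zero _ λ v → *-zeroʳ (adj G u v)

  #deg-zero : ∀ {i} → (∀ v → deg v ≢ i) → #deg G i ≡ 0
  #deg-zero {i} ≢i = sum-zero (λ v → δ (deg v) i) λ v → δ-≢ (≢i v)

  m-zero : ∀ i j → (∀ v → deg v ≢ i) → m G i j ≡ 0
  m-zero i j ≢i = m+n≡0⇒m≡0 (m G i j) (trans (sym (∑²-pair G i j))
    (trans (∑²-cong G λ {u} {v} _ → pair-≢ (λ p → ≢i u (proj₁ p)) (λ q → ≢i v (proj₂ q))) ∑²-zero))

  module _ {a : ℕ} {w : Fin n} (deg-w : deg w ≡ a) (unique : ∀ v → v ≢ w → deg v ≢ a) where

    #deg-unique : #deg G a ≡ 1
    #deg-unique = trans (sum-single (λ v → δ (deg v) a) w (λ v v≢w → δ-≢ (unique v v≢w)))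
      (trans (cong (λ x → δ x a) deg-w) (δ-refl a))

    -- Every edge counted by `m G a i` has `w` at one end. `f` marks the direction that starts at
    -- degree `a`, and `i ≢ a` ensures that only one of the two directions is marked.
    m-unique : ∀ i → i ≢ a → m G a i ≡ #neighbours G (_≟ i) w
    m-unique i i≢a = *-cancelˡ-≡ _ _ 2 (begin
      2 * m G a i
        ≡⟨ ∑²-pair G a i ⟨
      ∑² G (λ u v → pair a i (deg u) (deg v))
        ≡⟨ ∑²-cong G (λ {u} {v} _ → split (deg u) (deg v)) ⟩
      ∑² G (λ u v → f u v + f v u)
        ≡⟨ ∑²-+ G f (λ u v → f v u) ⟩
      ∑² G f + ∑² G (λ u v → f v u)
        ≡⟨ cong₂ _+_ ∑²-f (trans (∑²-flip G f) (trans ∑²-f (sym (+-identityʳ _)))) ⟩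
      2 * #neighbours G (_≟ i) w ∎)
      where
      open ≡-Reasoning
      f : Fin n → Fin n → ℕ
      f u v = δ (deg u) a * δ (deg v) i

      split : ∀ x y → pair a i x y ≡ δ x a * δ y i + δ y a * δ x i
      split x y with x ≟ a | y ≟ a
      ... | no x≢a | no y≢a
        rewrite δ-≢ x≢a | δ-≢ y≢a = pair-≢ (x≢a ∘ proj₁) (y≢a ∘ proj₂)
      ... | yes refl | yes refl
        rewrite δ-≢ (i≢a ∘ sym) | *-zeroʳ (δ a a) = pair-≢ (i≢a ∘ sym ∘ proj₂) (i≢a ∘ sym ∘ proj₁)
      ... | yes refl | no y≢a rewrite δ-refl a | δ-≢ y≢a | dec-true (x ≟ x) refl
            | dec-false (x ≟ i) (i≢a ∘ sym)
            with does (y ≟ i)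
      ...   | true  = refl
      ...   | false = refl
      split x y | no x≢a | yes refl rewrite δ-refl a | δ-≢ x≢a | dec-true (y ≟ y) refl
            | dec-false (y ≟ i) (i≢a ∘ sym) | dec-false (x ≟ y) x≢a
            with does (x ≟ i)
      ...   | true  = refl
      ...   | false = refl

      ∑²-f : ∑² G f ≡ #neighbours G (_≟ i) w
      ∑²-f = trans
        (sum-single (λ u → sum λ v → adj G u v * f u v) w λ u u≢w →
          sum-zero _ λ v → trans (cong (λ t → adj G u v * (t * δ (deg v) i)) (δ-≢ (unique u u≢w)))
                                 (*-zeroʳ (adj G u v)))
        (sum-cong-≗ λ v → trans
          (cong (adj G w v *_) (trans (cong (λ x → δ x a * δ (deg v) i) deg-w)
            (trans (cong (_* δ (deg v) i) (δ-refl a)) (*-identityˡ _))))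
          (sym (nbr-δ i w v)))

-- Eliminating the numbers of vertices of degree 1 and 2.

-- Here Δ = 2 + d, the medium degree is 2 + b, and the tree has 1 + N vertices.
record Balance (d b N nₐ nΔ m₂₂ mₐ₂ mₐΔ mΔΔ s : ℕ) : Set where
  field
    degrees : (2 + b) * nₐ + (2 + d) * nΔ + m₂₂ ≡ N + (mₐΔ + mΔΔ)
    weights : s + d ^ 2 * (mₐ₂ + 2 + 2 * (mₐΔ + mΔΔ)) ≡
              (1 + d) ^ 2 * (b * nₐ + d * nΔ + 2) + 2 * d ^ 2 * (nₐ + nΔ)
                + b ^ 2 * mₐ₂ + ∣ b - d ∣ ^ 2 * mₐΔ

module _ {d b N n₁ n₂ nₐ nΔ m₂₂ mₐ₂ mₐΔ mΔΔ s S : ℕ}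
  (vertex : suc N ≡ n₁ + n₂ + nₐ + nΔ)
  (degree : S ≡ 1 * n₁ + 2 * n₂ + (2 + b) * nₐ + (2 + d) * nΔ)
  (tree : S + 2 ≡ 2 * suc N)
  (edge : S + 2 * m₂₂ ≡ 2 * (1 * n₁) + 2 * (2 * n₂) + 2 * mₐΔ + 2 * mΔΔ)
  (weight : 2 * s + d ^ 2 * (2 * (2 * m₂₂) + 2 * mₐ₂) ≡
            (1 + d) ^ 2 * (2 * (1 * n₁)) + d ^ 2 * (2 * (2 * n₂)) + b ^ 2 * (2 * mₐ₂)
              + ∣ b - d ∣ ^ 2 * (2 * mₐΔ))
  where
  private
    X = (2 + b) * nₐ + (2 + d) * nΔ
    M = mₐΔ + mΔΔ
    open ≡-Reasoning

    -- Behind this is the count of ends of degree at least 3: one for each of the `N` edges, but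
    -- none at a 22 edge and two at an aΔ or ΔΔ edge.
    degrees : X + m₂₂ ≡ N + M
    degrees = *-cancelˡ-≡ _ _ 2 (+-cancelʳ-≡ (S + 2) _ _ (begin
      2 * (X + m₂₂) + (S + 2)
        ≡⟨ e₁ X m₂₂ S ⟩
      (S + 2 * m₂₂) + 2 * X + 2
        ≡⟨ cong (λ t → t + 2 * X + 2) edge ⟩
      2 * (1 * n₁) + 2 * (2 * n₂) + 2 * mₐΔ + 2 * mΔΔ + 2 * X + 2
        ≡⟨ e₂ n₁ n₂ nₐ nΔ mₐΔ mΔΔ b d ⟩
      2 * (1 * n₁ + 2 * n₂ + (2 + b) * nₐ + (2 + d) * nΔ) + 2 * M + 2
        ≡⟨ cong (λ t → 2 * t + 2 * M + 2) degree ⟨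
      2 * S + 2 * M + 2
        ≡⟨ e₃ S M ⟩
      S + (S + 2) + 2 * M
        ≡⟨ cong (λ t → S + t + 2 * M) tree ⟩
      S + 2 * suc N + 2 * M
        ≡⟨ e₄ S N M ⟩
      2 * (N + M) + (S + 2) ∎))
      where
      e₁ : ∀ x m s → 2 * (x + m) + (s + 2) ≡ s + 2 * m + 2 * x + 2
      e₁ = solve-∀
      e₂ : ∀ n₁ n₂ nₐ nΔ p q b d →
           2 * (1 * n₁) + 2 * (2 * n₂) + 2 * p + 2 * q + 2 * ((2 + b) * nₐ + (2 + d) * nΔ) + 2 ≡
           2 * (1 * n₁ + 2 * n₂ + (2 + b) * nₐ + (2 + d) * nΔ) + 2 * (p + q) + 2
      e₂ = solve-∀
      e₃ : ∀ s m → 2 * s + 2 * m + 2 ≡ s + (s + 2) + 2 * m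
      e₃ = solve-∀
      e₄ : ∀ s n m → s + 2 * (1 + n) + 2 * m ≡ 2 * (n + m) + (s + 2)
      e₄ = solve-∀

    twice : 1 * n₁ + 2 * n₂ + X + 2 ≡ 2 * (n₁ + n₂ + nₐ + nΔ)
    twice = begin
      1 * n₁ + 2 * n₂ + X + 2
        ≡⟨ cong (_+ 2) (trans (sym (+-assoc (1 * n₁ + 2 * n₂) _ _)) (sym degree)) ⟩
      S + 2
        ≡⟨ trans tree (cong (2 *_) vertex) ⟩
      2 * (n₁ + n₂ + nₐ + nΔ) ∎

    -- In a tree the numbers degree minus 2 add up to -2, and only leaves contribute negatively.
    leaves : n₁ ≡ b * nₐ + d * nΔ + 2
    leaves = +-cancelʳ-≡ (n₁ + 2 * n₂ + 2 * nₐ + 2 * nΔ) _ _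
      (trans (e₁ n₁ n₂ nₐ nΔ) (trans (sym twice) (e₂ n₁ n₂ nₐ nΔ b d)))
      where
      e₁ : ∀ n₁ n₂ nₐ nΔ → n₁ + (n₁ + 2 * n₂ + 2 * nₐ + 2 * nΔ) ≡ 2 * (n₁ + n₂ + nₐ + nΔ)
      e₁ = solve-∀
      e₂ : ∀ n₁ n₂ nₐ nΔ b d → 1 * n₁ + 2 * n₂ + ((2 + b) * nₐ + (2 + d) * nΔ) + 2 ≡
           b * nₐ + d * nΔ + 2 + (n₁ + 2 * n₂ + 2 * nₐ + 2 * nΔ)
      e₂ = solve-∀

    -- In the tree: delete the leaves and suppress the vertices of degree 2. What remains is a tree
    -- on `nₐ + nΔ` vertices, each of whose edges is either one of the `M` direct edges or a path
    -- through degree-2 vertices, which has one such vertex more than 22 edges.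
    twos : n₂ + 1 + M ≡ nₐ + nΔ + m₂₂
    twos = +-cancelʳ-≡ (n₁ + N + n₂ + 1) _ _ (begin
      n₂ + 1 + M + (n₁ + N + n₂ + 1)
        ≡⟨ e₁ n₁ n₂ N M ⟩
      1 * n₁ + 2 * n₂ + (N + M) + 2
        ≡⟨ cong (λ t → 1 * n₁ + 2 * n₂ + t + 2) degrees ⟨
      1 * n₁ + 2 * n₂ + (X + m₂₂) + 2
        ≡⟨ e₂ n₁ n₂ X m₂₂ ⟩
      1 * n₁ + 2 * n₂ + X + 2 + m₂₂
        ≡⟨ cong (_+ m₂₂) twice ⟩
      2 * (n₁ + n₂ + nₐ + nΔ) + m₂₂
        ≡⟨ e₃ n₁ n₂ nₐ nΔ m₂₂ ⟩
      (n₁ + n₂ + nₐ + nΔ) + (nₐ + nΔ + m₂₂ + n₁ + n₂)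
        ≡⟨ cong (_+ (nₐ + nΔ + m₂₂ + n₁ + n₂)) vertex ⟨
      suc N + (nₐ + nΔ + m₂₂ + n₁ + n₂)
        ≡⟨ e₄ n₁ n₂ nₐ nΔ m₂₂ N ⟩
      nₐ + nΔ + m₂₂ + (n₁ + N + n₂ + 1) ∎)
      where
      e₁ : ∀ n₁ n₂ N M → n₂ + 1 + M + (n₁ + N + n₂ + 1) ≡ 1 * n₁ + 2 * n₂ + (N + M) + 2
      e₁ = solve-∀
      e₂ : ∀ n₁ n₂ X m → 1 * n₁ + 2 * n₂ + (X + m) + 2 ≡ 1 * n₁ + 2 * n₂ + X + 2 + m
      e₂ = solve-∀
      e₃ : ∀ n₁ n₂ nₐ nΔ m → 2 * (n₁ + n₂ + nₐ + nΔ) + m ≡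
           (n₁ + n₂ + nₐ + nΔ) + (nₐ + nΔ + m + n₁ + n₂)
      e₃ = solve-∀
      e₄ : ∀ n₁ n₂ nₐ nΔ m N → 1 + N + (nₐ + nΔ + m + n₁ + n₂) ≡ nₐ + nΔ + m + (n₁ + N + n₂ + 1)
      e₄ = solve-∀

    weights : s + d ^ 2 * (mₐ₂ + 2 + 2 * M) ≡
              (1 + d) ^ 2 * (b * nₐ + d * nΔ + 2) + 2 * d ^ 2 * (nₐ + nΔ)
                + b ^ 2 * mₐ₂ + ∣ b - d ∣ ^ 2 * mₐΔ
    weights = *-cancelˡ-≡ _ _ 2 (+-cancelʳ-≡ (D * (4 * m₂₂)) _ _ (begin
      2 * (s + D * (mₐ₂ + 2 + 2 * M)) + D * (4 * m₂₂)
        ≡⟨ e₁ s D mₐ₂ M m₂₂ ⟩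
      -- `4 * D * (1 + M)` completes `n₂` to the left side of `twos`, and then the `m₂₂` terms
      -- cancel. This is the origin of `2 + 2 * (mₐΔ + mΔΔ)` in `Balance`.
      2 * s + D * (2 * (2 * m₂₂) + 2 * mₐ₂) + 4 * D * (1 + M)
        ≡⟨ cong (_+ 4 * D * (1 + M)) weight ⟩
      P * (2 * (1 * n₁)) + D * (2 * (2 * n₂)) + T * (2 * mₐ₂) + U * (2 * mₐΔ) + 4 * D * (1 + M)
        ≡⟨ e₂ P D T U n₁ n₂ mₐ₂ mₐΔ M ⟩
      2 * (P * n₁) + 4 * D * (n₂ + 1 + M) + T * (2 * mₐ₂) + U * (2 * mₐΔ)
        ≡⟨ cong₂ (λ x y → 2 * (P * x) + 4 * D * y + T * (2 * mₐ₂) + U * (2 * mₐΔ)) leaves twos ⟩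
      2 * (P * L) + 4 * D * (nₐ + nΔ + m₂₂) + T * (2 * mₐ₂) + U * (2 * mₐΔ)
        ≡⟨ e₃ P D T U L nₐ nΔ m₂₂ mₐ₂ mₐΔ ⟩
      2 * (P * L + 2 * D * (nₐ + nΔ) + T * mₐ₂ + U * mₐΔ) + D * (4 * m₂₂) ∎))
      where
      P = (1 + d) ^ 2
      D = d ^ 2
      T = b ^ 2
      U = ∣ b - d ∣ ^ 2
      L = b * nₐ + d * nΔ + 2
      e₁ : ∀ s D a M m → 2 * (s + D * (a + 2 + 2 * M)) + D * (4 * m) ≡
           2 * s + D * (2 * (2 * m) + 2 * a) + 4 * D * (1 + M)
      e₁ = solve-∀
      e₂ : ∀ P D T U n₁ n₂ a c M →
           P * (2 * (1 * n₁)) + D * (2 * (2 * n₂)) + T * (2 * a) + U * (2 * c) + 4 * D * (1 + M) ≡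
           2 * (P * n₁) + 4 * D * (n₂ + 1 + M) + T * (2 * a) + U * (2 * c)
      e₂ = solve-∀
      e₃ : ∀ P D T U L x y m a c →
           2 * (P * L) + 4 * D * (x + y + m) + T * (2 * a) + U * (2 * c) ≡
           2 * (P * L + 2 * D * (x + y) + T * a + U * c) + D * (4 * m)
      e₃ = solve-∀

  balance : Balance d b N nₐ nΔ m₂₂ mₐ₂ mₐΔ mΔΔ s
  balance = record { degrees = degrees ; weights = weights }

-- The balance equations for members of the three families.

module Families {N d : ℕ} (4≤d : 4 ≤ d) (G : Graph (suc N)) where
  open Graph G

  private
    Δ = 2 + d
    deg = degree G

    2<Δ : 2 < Δ
    2<Δ = s≤s (s≤s (≤-trans (s≤s z≤n) 4≤d))

    d≢ : ∀ {i} → i < 4 → i ≢ d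
    d≢ i<4 = <⇒≢ (<-≤-trans i<4 4≤d)

  module _ (tree : IsTree G) (maxDegree : HasMaxDegree G Δ)
           (internalLeaves : InternalLeavesHaveDegree G Δ) where
    open Leaves G 2<Δ tree maxDegree internalLeaves

    tree-balance : ∀ {b} → 1 ≤ b → b < d →
      (∀ v → Allowed Δ (2 + b) (deg v)) →
      (∀ {u v} → Adj u v → deg u ≡ 2 + b → deg v ≡ 2 ⊎ deg v ≡ Δ) →
      Balance d b N (#deg G (2 + b)) (#deg G Δ) (m G 2 2) (m G (2 + b) 2) (m G (2 + b) Δ) (m G Δ Δ) (σ G)
    tree-balance {b} 1≤b b<d degrees medium-neighbour = balance {d} {b} {N} {#deg G 1} {#deg G 2}
      (vertex-count G 3≤a a<Δ degrees)
      (degree-sum G 3≤a a<Δ degrees)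
      (sum-degrees G tree)
      (edge-count G 3≤a a<Δ edges)
      (edge-weight G 3≤a a<Δ edges)
      where
      3≤a : 3 ≤ 2 + b
      3≤a = s≤s (s≤s 1≤b)
      a<Δ : 2 + b < Δ
      a<Δ = s≤s (s≤s b<d)
      edges : ∀ {u v} → Adj u v → EdgeType Δ (2 + b) (deg u) (deg v)
                                ⊎ EdgeType Δ (2 + b) (deg v) (deg u)
      edges = edge-type 3≤a a<Δ degrees medium-neighbour

    -- `tree-balance` asks for a medium degree; 3 serves as one that no vertex has, so that its
    -- vertex and edge numbers are 0.
    no-medium-balance : (∀ v → DegreeIn12 G Δ v) →
      Balance d 1 N 0 (#deg G Δ) (m G 2 2) 0 0 (m G Δ Δ) (σ G)
    no-medium-balance degrees = subst (λ c → Balance d 1 N c (#deg G Δ) (m G 2 2) 0 0 (m G Δ Δ) (σ G))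
      (#deg-zero G ≢3)
      (subst₂ (λ p q → Balance d 1 N (#deg G 3) (#deg G Δ) (m G 2 2) p q (m G Δ Δ) (σ G))
        (m-zero G 3 2 ≢3) (m-zero G 3 Δ ≢3)
        (tree-balance ≤-refl (≤-trans (s≤s (s≤s z≤n)) 4≤d) degrees′
          (λ {u} _ du≡3 → contradiction du≡3 (≢3 u))))
      where
      ≢3 : ∀ v → deg v ≢ 3
      ≢3 v dv≡3 with degrees v
      ... | inj₁ dv≡1 with () ← trans (sym dv≡1) dv≡3
      ... | inj₂ (inj₁ dv≡2) with () ← trans (sym dv≡2) dv≡3
      ... | inj₂ (inj₂ dv≡Δ) = d≢ (s≤s (s≤s z≤n)) (cong (_∸ 2) (trans (sym dv≡3) dv≡Δ))

      degrees′ : ∀ v → Allowed Δ 3 (deg v)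
      degrees′ v with degrees v
      ... | inj₁ dv≡1        = inj₁ dv≡1
      ... | inj₂ (inj₁ dv≡2) = inj₂ (inj₁ dv≡2)
      ... | inj₂ (inj₂ dv≡Δ) = inj₂ (inj₂ (inj₂ dv≡Δ))

    -- As `p + q` is the degree of `w`, its neighbours of degree 2 and Δ exhaust its neighbourhood:
    -- any other neighbour would make `p + q` strictly smaller than `deg w`.
    medium-balance : ∀ {b p q} w → 1 ≤ b → b < d → deg w ≡ 2 + b →
      (∀ v → v ≢ w → DegreeIn12 G Δ v) →
      #neighbours G (_≟ 2) w ≡ p → #neighbours G (_≟ Δ) w ≡ q → p + q ≡ 2 + b →
      Balance d b N 1 (#deg G Δ) (m G 2 2) p q (m G Δ Δ) (σ G)
    medium-balance {b} {p} {q} w 1≤b b<d deg-w degrees np nq p+q =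
      subst (λ c → Balance d b N c (#deg G Δ) (m G 2 2) p q (m G Δ Δ) (σ G))
        (#deg-unique G deg-w unique)
        (subst₂ (λ p q → Balance d b N (#deg G (2 + b)) (#deg G Δ) (m G 2 2) p q (m G Δ Δ) (σ G))
          (trans (m-unique G deg-w unique 2 2≢a) np)
          (trans (m-unique G deg-w unique Δ Δ≢a) nq)
          (tree-balance 1≤b b<d degrees′ medium-neighbour))
      where
      2≢a : 2 ≢ 2 + b
      2≢a = <⇒≢ (s≤s (s≤s 1≤b))
      Δ≢a : Δ ≢ 2 + b
      Δ≢a eq = <⇒≢ b<d (cong (_∸ 2) (sym eq))

      unique : ∀ v → v ≢ w → deg v ≢ 2 + b
      unique v v≢w dv≡a with degrees v v≢w
      ... | inj₁ dv≡1 with () ← trans (sym dv≡1) dv≡a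
      ... | inj₂ (inj₁ dv≡2) = 2≢a (trans (sym dv≡2) dv≡a)
      ... | inj₂ (inj₂ dv≡Δ) = Δ≢a (trans (sym dv≡Δ) dv≡a)

      degrees′ : ∀ v → Allowed Δ (2 + b) (deg v)
      degrees′ v with v Fin.≟ w
      ... | yes refl = inj₂ (inj₂ (inj₁ deg-w))
      ... | no  v≢w with degrees v v≢w
      ...   | inj₁ dv≡1        = inj₁ dv≡1
      ...   | inj₂ (inj₁ dv≡2) = inj₂ (inj₁ dv≡2)
      ...   | inj₂ (inj₂ dv≡Δ) = inj₂ (inj₂ (inj₂ dv≡Δ))

      two-or-Δ : ∀ {v} → Adj w v → deg v ≡ 2 ⊎ deg v ≡ Δ
      two-or-Δ {v} e with deg v ≟ 2 | deg v ≟ Δ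
      ... | yes dv≡2 | _        = inj₁ dv≡2
      ... | no  _    | yes dv≡Δ = inj₂ dv≡Δ
      ... | no  dv≢2 | no  dv≢Δ = contradiction total (<⇒≢ strict)
        where
        f : Fin (suc N) → ℕ
        f u = nbr G (_≟ 2) w u + nbr G (_≟ Δ) w u
        f≤adj : ∀ u → f u ≤ adj G w u
        f≤adj u with deg u ≟ 2
        ... | yes du≡2 = subst (_≤ adj G w u)
          (trans (sym (+-identityʳ _)) (cong (nbr G (_≟ 2) w u +_)
            (sym (nbr-false G (_≟ Δ) {w} {u} λ du≡Δ → <⇒≢ 2<Δ (trans (sym du≡2) du≡Δ)))))
          (nbr≤adj G (_≟ 2) w u)
        ... | no  du≢2 = subst (_≤ adj G w u)
          (cong (_+ nbr G (_≟ Δ) w u) (sym (nbr-false G (_≟ 2) {w} {u} du≢2)))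
          (nbr≤adj G (_≟ Δ) w u)
        strict : sum f < deg w
        strict = sum-mono-< f≤adj v
          (subst₂ _<_ (sym (cong₂ _+_ (nbr-false G (_≟ 2) {w} {v} dv≢2) (nbr-false G (_≟ Δ) {w} {v} dv≢Δ)))
            (sym (adj-true G e)) (s≤s z≤n))
        total : sum f ≡ deg w
        total = trans (∑-distrib-+ (nbr G (_≟ 2) w) (nbr G (_≟ Δ) w))
          (trans (cong₂ _+_ np nq) (trans p+q (sym deg-w)))

      medium-neighbour : ∀ {u v} → Adj u v → deg u ≡ 2 + b → deg v ≡ 2 ⊎ deg v ≡ Δ
      medium-neighbour {u} e du≡a with u Fin.≟ w
      ... | yes refl = two-or-Δ e
      ... | no  u≢w  = contradiction du≡a (unique u u≢w)

module _ {N d : ℕ} (4≤d : 4 ≤ d) (G : Graph (suc N)) where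
  open Graph G
  open Families 4≤d G

  private
    Δ = 2 + d
    deg = degree G

    2<Δ : 2 < Δ
    2<Δ = s≤s (s≤s (≤-trans (s≤s z≤n) 4≤d))

  degreeIn12 : ∀ {v} → 1 ≤ deg v → deg v ≤ Δ → ¬ (3 ≤ deg v × deg v < Δ) → DegreeIn12 G Δ v
  degreeIn12 {v} 1≤dv dv≤Δ ¬medium with deg v ≟ 1 | deg v ≟ 2 | deg v ≟ Δ
  ... | yes dv≡1 | _        | _        = inj₁ dv≡1
  ... | no  _    | yes dv≡2 | _        = inj₂ (inj₁ dv≡2)
  ... | no  _    | no  _    | yes dv≡Δ = inj₂ (inj₂ dv≡Δ)
  ... | no  dv≢1 | no  dv≢2 | no  dv≢Δ = contradiction
    (≤∧≢⇒< (≤∧≢⇒< 1≤dv (dv≢1 ∘ sym)) (dv≢2 ∘ sym) , ≤∧≢⇒< dv≤Δ dv≢Δ) ¬medium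

  medium-index : ∀ {i} → 3 ≤ i → i < Δ → ∃[ k ] 3 + toℕ {Δ ∸ 3} k ≡ i
  medium-index {i} 3≤i i<Δ with m≤n⇒∃[o]m+o≡n 3≤i
  ... | o , refl = fromℕ< o< , cong (3 +_) (Fin.toℕ-fromℕ< o<)
    where
    o< : o < Δ ∸ 3
    o< = ∸-monoˡ-≤ 3 i<Δ

  #deg≤#medium : ∀ {i} → 3 ≤ i → i < Δ → #deg G i ≤ #medium G Δ
  #deg≤#medium 3≤i i<Δ with medium-index 3≤i i<Δ
  ... | k , refl = term≤sum (λ k → #deg G (3 + toℕ k)) k

  #deg+#deg≤#medium : ∀ {i i′} → 3 ≤ i → i < Δ → 3 ≤ i′ → i′ < Δ → i ≢ i′ →
                      #deg G i + #deg G i′ ≤ #medium G Δ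
  #deg+#deg≤#medium 3≤i i<Δ 3≤i′ i′<Δ i≢i′ with medium-index 3≤i i<Δ | medium-index 3≤i′ i′<Δ
  ... | k , refl | k′ , refl = two-terms≤sum (λ k → #deg G (3 + toℕ k)) {k} {k′} λ { refl → i≢i′ refl }

  #deg≥1 : ∀ v → 1 ≤ #deg G (deg v)
  #deg≥1 v = subst (_≤ #deg G (deg v)) (δ-refl (deg v)) (term≤sum (λ u → δ (deg u) (deg v)) v)

  private
    value = σ G

  𝒯′-balance : 𝒯′ (suc N) Δ G →
    (∃[ s ] ∃[ nΔ ] 1 ≤ s × s ≤ 2 × Balance d 1 N 0 nΔ s 0 0 0 value) ⊎
    (∃[ b ] ∃[ nΔ ] 1 ≤ b × b < d × Balance d b N 1 nΔ 0 (2 + b) 0 0 value)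
  𝒯′-balance T = cases (m G 2 2 ≟ 0)
    where
    open 𝒯′ T
    open Leaves G 2<Δ tree maxDegree internalLeaves using (deg≥1)

    cases : Dec (m G 2 2 ≡ 0) → _
    cases (no m₂₂≢0) = inj₁ (m G 2 2 , #deg G Δ , n≢0⇒n>0 m₂₂≢0 , m₂₂≤2 ,
      subst (λ t → Balance d 1 N 0 (#deg G Δ) (m G 2 2) 0 0 t value) mΔΔ≡0
        (no-medium-balance tree maxDegree internalLeaves λ v →
          degreeIn12 (deg≥1 v) (proj₁ maxDegree v) (none v)))
      where
      none : ∀ v → ¬ (3 ≤ deg v × deg v < Δ)
      -- `#deg G (deg v)` lies between 1 and `#medium G Δ`, which is at most 1. So `deg v` would be
      -- the only medium degree, forcing `m G 2 2 ≡ 0`.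
      none v (3≤dv , dv<Δ) = m₂₂≢0 (Equivalence.from m₂₂≡0⇔medium
        (deg v , (3≤dv , s≤s⁻¹ dv<Δ)
        , ≤-antisym (≤-trans medium≤1 (#deg≥1 v)) (#deg≤#medium 3≤dv dv<Δ)
        , ≤-antisym (≤-trans (#deg≤#medium 3≤dv dv<Δ) medium≤1) (#deg≥1 v)))
    cases (yes m₂₂≡0) with Equivalence.to m₂₂≡0⇔medium m₂₂≡0
    ... | a , only@((3≤a , a≤Δ-1) , medium≡ , #a≡1) with m≤n⇒∃[o]m+o≡n (≤-trans (s≤s (s≤s z≤n)) 3≤a)
    ... | b , refl = inj₂ (b , #deg G Δ , 1≤b , b<d ,
      subst₂ (λ p q → Balance d b N 1 (#deg G Δ) p (2 + b) 0 q value) m₂₂≡0 mΔΔ≡0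
        (medium-balance tree maxDegree internalLeaves w 1≤b b<d deg-w degrees nbrs₂ nbrsΔ (+-identityʳ _)))
      where
      1≤b : 1 ≤ b
      1≤b = s≤s⁻¹ (s≤s⁻¹ 3≤a)
      b<d : b < d
      b<d = s≤s⁻¹ a≤Δ-1
      a<Δ : 2 + b < Δ
      a<Δ = s≤s (s≤s b<d)

      found : ∃[ w ] 0 < δ (deg w) (2 + b)
      found = sum-positive (λ v → δ (deg v) (2 + b)) (subst (0 <_) (sym #a≡1) (s≤s z≤n))
      w = proj₁ found

      deg-w : deg w ≡ 2 + b
      deg-w with deg w ≟ 2 + b
      ... | yes dw≡a = dw≡a
      ... | no  dw≢a = contradiction (subst (0 <_) (δ-≢ dw≢a) (proj₂ found)) λ ()

      unique : ∀ v → v ≢ w → deg v ≢ 2 + b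
      unique v v≢w dv≡a = contradiction
        (subst₂ _≤_ (cong₂ _+_ (trans (cong (λ x → δ x (2 + b)) dv≡a) (δ-refl (2 + b)))
                               (trans (cong (λ x → δ x (2 + b)) deg-w) (δ-refl (2 + b))))
                    #a≡1 (two-terms≤sum (λ u → δ (deg u) (2 + b)) v≢w))
        λ { (s≤s ()) }

      degrees : ∀ v → v ≢ w → DegreeIn12 G Δ v
      degrees v v≢w = degreeIn12 (deg≥1 v) (proj₁ maxDegree v) λ (3≤dv , dv<Δ) →
        contradiction
          (≤-trans (+-mono-≤ (≤-reflexive (sym #a≡1)) (#deg≥1 v))
            (≤-trans (#deg+#deg≤#medium 3≤a a<Δ 3≤dv dv<Δ (unique v v≢w ∘ sym)) medium≤1))
          λ { (s≤s ()) }

      nbrs₂ : #neighbours G (_≟ 2) w ≡ 2 + b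
      nbrs₂ = trans (sym (m-unique G deg-w unique 2 (<⇒≢ 3≤a))) (mₐ₂≡a m₂₂≡0 (2 + b) only)

      nbrsΔ : #neighbours G (_≟ Δ) w ≡ 0
      nbrsΔ = sum-zero (nbr G (_≟ Δ) w) zeros
        where
        all₂ : ∀ {u} → Adj w u → deg u ≡ 2
        all₂ {u} e with deg u ≟ 2
        ... | yes du≡2 = du≡2
        ... | no  du≢2 = contradiction (trans nbrs₂ (sym deg-w)) (<⇒≢
          (sum-mono-< (nbr≤adj G (_≟ 2) w) u
            (subst₂ _<_ (sym (nbr-false G (_≟ 2) {w} {u} du≢2)) (sym (adj-true G e)) (s≤s z≤n))))
        zeros : ∀ u → nbr G (_≟ Δ) w u ≡ 0
        zeros u with adj? w u
        ... | no  _ = refl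
        ... | yes e = δ-≢ (λ du≡Δ → <⇒≢ 2<Δ (trans (sym (all₂ e)) du≡Δ))

  𝒯″-balance : 𝒯″ (suc N) Δ G →
    ∃[ nΔ ] ∃[ mΔΔ ] mΔΔ ≤ 1 + d × Balance d 1 N 0 nΔ 0 0 0 mΔΔ value
  𝒯″-balance T = #deg G Δ , m G Δ Δ , mΔΔ≤Δ-1 ,
    subst (λ t → Balance d 1 N 0 (#deg G Δ) t 0 0 (m G Δ Δ) value) m₂₂≡0
      (no-medium-balance tree maxDegree internalLeaves degrees)
    where open 𝒯″ T

  𝒯‴-balance : ∀ {j b} → j ≡ suc b → 1 ≤ b → b < d → 𝒯‴ (suc N) Δ j G →
    ∃[ nΔ ] Balance d b N 1 nΔ 0 (suc b) 1 0 value
  𝒯‴-balance {b = b} refl 1≤b b<d T = #deg G Δ ,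
    subst₂ (λ p q → Balance d b N 1 (#deg G Δ) p (suc b) 1 q value) m₂₂≡0 mΔΔ≡0
      (medium-balance tree maxDegree internalLeaves w 1≤b b<d (trans degree-w (+-comm (suc b) 1))
        degrees w-neighbours₂ w-neighboursΔ (+-comm (suc b) 1))
    where open 𝒯‴ T

-- The values of σ in the three families.

division-unique : ∀ D {x p y q} → p < D → q < D → D * x + p ≡ y * D + q → x ≡ y × p ≡ q
division-unique D {x} {p} {y} {q} p<D q<D eq with <-cmp x y
... | tri≈ _ refl _ = refl , +-cancelˡ-≡ (D * x) _ _ (trans eq (cong (_+ q) (*-comm x D)))
... | tri< x<y _ _ = contradiction eq (<⇒≢ (begin-strict
  D * x + p  <⟨ +-monoʳ-< (D * x) p<D ⟩
  D * x + D  ≡⟨ trans (+-comm _ D) (sym (*-suc D x)) ⟩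
  D * suc x  ≤⟨ *-monoʳ-≤ D x<y ⟩
  D * y      ≡⟨ *-comm D y ⟩
  y * D      ≤⟨ m≤m+n _ q ⟩
  y * D + q  ∎))
  where open ≤-Reasoning
... | tri> _ _ y<x = contradiction (sym eq) (<⇒≢ (begin-strict
  y * D + q  <⟨ +-monoʳ-< (y * D) q<D ⟩
  y * D + D  ≡⟨ +-comm _ D ⟩
  suc y * D  ≤⟨ *-monoˡ-≤ D y<x ⟩
  x * D      ≡⟨ *-comm x D ⟩
  D * x      ≤⟨ m≤m+n _ p ⟩
  D * x + p  ∎))
  where open ≤-Reasoning

-- B of the paper, in terms of d = Δ - 2.  Below, the identities given to the ring solver
-- spell out x ^ 2 as x * (x * 1), to which it reduces, since the solver rejects powers.
base : ℕ → ℕ → ℕ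
base d k = k * (d * ((1 + d) ^ 2 + 2 * d))

module _ {d k j : ℕ} (1≤j : 1 ≤ j) (j≤1+d : j ≤ 1 + d) (4≤d : 4 ≤ d) where
  open ≡-Reasoning

  private
    N = k * (2 + d) + j
    j<Δ : j < 2 + d
    j<Δ = s≤s j≤1+d

  -- The degree equation reads Δ nΔ + s = k Δ + j with `s` and `j` below Δ, so nΔ = k and s = j.
  σ′-small : ∀ {s nΔ v} → s ≤ 2 → Balance d 1 N 0 nΔ s 0 0 0 v → s ≡ j × v ≡ base d k + 4 * d + 2
  σ′-small {s} {nΔ} {v} s≤2 B
    with division-unique (2 + d) {nΔ} {s} {k} {j} (≤-<-trans s≤2 (s≤s (s≤s (≤-trans (s≤s z≤n) 4≤d)))) j<Δ
           (trans (Balance.degrees B) (+-identityʳ N))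
  ... | refl , refl = refl , +-cancelʳ-≡ (d ^ 2 * (0 + 2 + 2 * (0 + 0))) _ _
    (trans (Balance.weights B) (expand d k (∣ 1 - d ∣ ^ 2)))
    where
    expand : ∀ d k u →
      (1 + d) * ((1 + d) * 1) * (1 * 0 + d * k + 2) + 2 * (d * (d * 1)) * (0 + k) + 1 * 0 + u * 0 ≡
      k * (d * ((1 + d) * ((1 + d) * 1) + 2 * d)) + 4 * d + 2 + d * (d * 1) * (0 + 2 + 2 * (0 + 0))
    expand = solve-∀

  σ′-large : ∀ {b nΔ v} → b < d → Balance d b N 1 nΔ 0 (2 + b) 0 0 v →
             2 + b ≡ j × v ≡ base d k + (2 + b) * (2 * d + 1) + (2 + b) * b ^ 2
  σ′-large {b} {nΔ} {v} b<d B
    with division-unique (2 + d) {nΔ} {2 + b} {k} {j} (s≤s (s≤s b<d)) j<Δ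
           (trans (shuffle b d nΔ) (trans (Balance.degrees B) (+-identityʳ N)))
    where
    shuffle : ∀ b d n → (2 + d) * n + (2 + b) ≡ (2 + b) * 1 + (2 + d) * n + 0
    shuffle = solve-∀
  ... | refl , refl = refl , +-cancelʳ-≡ (d ^ 2 * (2 + b + 2 + 2 * (0 + 0))) _ _
    (trans (Balance.weights B) (expand d k b (∣ b - d ∣ ^ 2)))
    where
    expand : ∀ d k b u →
      (1 + d) * ((1 + d) * 1) * (b * 1 + d * k + 2) + 2 * (d * (d * 1)) * (1 + k)
        + b * (b * 1) * (2 + b) + u * 0 ≡
      k * (d * ((1 + d) * ((1 + d) * 1) + 2 * d)) + (2 + b) * (2 * d + 1) + (2 + b) * (b * (b * 1))
        + d * (d * 1) * (2 + b + 2 + 2 * (0 + 0))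
    expand = solve-∀

  -- `j + c` is divisible by Δ and lies strictly between 0 and 2Δ, so it equals Δ, and the carry
  -- raises `nΔ` from `k` to `suc k`.
  overflow : ∀ {nΔ c} → c ≤ 1 + d → (2 + d) * nΔ ≡ N + c → nΔ ≡ suc k × j + c ≡ 2 + d
  overflow {nΔ} {c} c≤1+d eq with j + c <? 2 + d
  ... | yes j+c<Δ = contradiction
    (proj₂ (division-unique (2 + d) {nΔ} {0} {k} (s≤s z≤n) j+c<Δ
      (trans (+-identityʳ _) (trans eq (+-assoc (k * (2 + d)) j c)))))
    (<⇒≢ (≤-trans 1≤j (m≤m+n j c)))
  ... | no  j+c≮Δ with m≤n⇒∃[o]m+o≡n (≮⇒≥ j+c≮Δ)
  ...   | e , Δ+e≡j+c with division-unique (2 + d) {nΔ} {0} {suc k} {e} (s≤s z≤n) e<Δ (begin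
    (2 + d) * nΔ + 0            ≡⟨ +-identityʳ _ ⟩
    (2 + d) * nΔ                ≡⟨ eq ⟩
    k * (2 + d) + j + c         ≡⟨ +-assoc (k * (2 + d)) j c ⟩
    k * (2 + d) + (j + c)       ≡⟨ cong (k * (2 + d) +_) Δ+e≡j+c ⟨
    k * (2 + d) + (2 + d + e)   ≡⟨ shuffle k d e ⟩
    suc k * (2 + d) + e         ∎)
    where
    shuffle : ∀ k d e → k * (2 + d) + (2 + d + e) ≡ (1 + k) * (2 + d) + e
    shuffle = solve-∀
    e<Δ : e < 2 + d
    e<Δ = +-cancelˡ-< (2 + d) e (2 + d)
      (subst (_< 2 + d + (2 + d)) (sym Δ+e≡j+c) (+-mono-< j<Δ (s≤s c≤1+d)))
  ...     | nΔ≡ , refl = nΔ≡ , trans (sym Δ+e≡j+c) (+-identityʳ _)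

  σ″-value : ∀ {nΔ c v} → c ≤ 1 + d → Balance d 1 N 0 nΔ 0 0 0 c v →
             v + d ^ 3 ≡ base d k + 5 * d + 2 + 2 * j * d ^ 2
  σ″-value {nΔ} {c} {v} c≤1+d B
    with overflow {nΔ} {c} c≤1+d (trans (sym (+-identityʳ _)) (Balance.degrees B))
  ... | refl , j+c≡Δ = +-cancelʳ-≡ (d ^ 2 * (2 + 2 * c)) _ _ (begin
    v + d ^ 3 + d ^ 2 * (2 + 2 * c)
      ≡⟨ swap v (d ^ 3) (d ^ 2 * (2 + 2 * c)) ⟩
    v + d ^ 2 * (2 + 2 * c) + d ^ 3
      ≡⟨ cong (_+ d ^ 3) (Balance.weights B) ⟩
    (1 + d) ^ 2 * (1 * 0 + d * suc k + 2) + 2 * d ^ 2 * suc k + 1 * 0 + ∣ 1 - d ∣ ^ 2 * 0 + d ^ 3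
      ≡⟨ expand d k (∣ 1 - d ∣ ^ 2) ⟩
    base d k + 5 * d + 2 + 2 * d ^ 2 * (2 + d) + d ^ 2 * 2
      ≡⟨ cong (λ t → base d k + 5 * d + 2 + 2 * d ^ 2 * t + d ^ 2 * 2) j+c≡Δ ⟨
    base d k + 5 * d + 2 + 2 * d ^ 2 * (j + c) + d ^ 2 * 2
      ≡⟨ collect (base d k) d (d ^ 2) j c ⟩
    base d k + 5 * d + 2 + 2 * j * d ^ 2 + d ^ 2 * (2 + 2 * c) ∎)
    where
    swap : ∀ x y z → x + y + z ≡ x + z + y
    swap = solve-∀
    expand : ∀ d k u →
      (1 + d) * ((1 + d) * 1) * (1 * 0 + d * (1 + k) + 2) + 2 * (d * (d * 1)) * (1 + k)
        + 1 * 0 + u * 0 + d * (d * (d * 1)) ≡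
      k * (d * ((1 + d) * ((1 + d) * 1) + 2 * d)) + 5 * d + 2 + 2 * (d * (d * 1)) * (2 + d)
        + d * (d * 1) * 2
    expand = solve-∀
    collect : ∀ b d q j c → b + 5 * d + 2 + 2 * q * (j + c) + q * 2 ≡
              b + 5 * d + 2 + 2 * j * q + q * (2 + 2 * c)
    collect = solve-∀

  -- The single aΔ edge adds 1 to the right of the degree equation. The remainder there becomes j +
  -- 1, which is the medium degree, so again nΔ = k.
  σ‴-value : ∀ {b nΔ v} → b < d → j ≡ suc b → Balance d b N 1 nΔ 0 (suc b) 1 0 v →
             v + j ^ 2 ≡ base d k + 4 * d + 2 + j ^ 3
  σ‴-value {b} {nΔ} {v} b<d refl B
    with division-unique (2 + d) {nΔ} {2 + b} {k} {2 + b} (s≤s (s≤s b<d)) (s≤s (s≤s b<d))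
           (trans (shuffle b d nΔ) (trans (Balance.degrees B) (shift-one (k * (2 + d)) b)))
       | m≤n⇒∃[o]m+o≡n (<⇒≤ b<d)
    where
    shuffle : ∀ b d n → (2 + d) * n + (2 + b) ≡ (2 + b) * 1 + (2 + d) * n + 0
    shuffle = solve-∀
    shift-one : ∀ x b → x + (1 + b) + (1 + 0) ≡ x + (2 + b)
    shift-one = solve-∀
  ... | refl , _ | e , refl = +-cancelʳ-≡ (d ^ 2 * (suc b + 2 + 2 * (1 + 0))) _ _ (begin
    v + j ^ 2 + d ^ 2 * (suc b + 2 + 2 * (1 + 0))
      ≡⟨ swap v (j ^ 2) (d ^ 2 * (suc b + 2 + 2 * (1 + 0))) ⟩
    v + d ^ 2 * (suc b + 2 + 2 * (1 + 0)) + j ^ 2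
      ≡⟨ cong (_+ j ^ 2) (Balance.weights B) ⟩
    (1 + d) ^ 2 * (b * 1 + d * k + 2) + 2 * d ^ 2 * (1 + k) + b ^ 2 * suc b + ∣ b - d ∣ ^ 2 * 1 + j ^ 2
      ≡⟨ cong (λ t → (1 + d) ^ 2 * (b * 1 + d * k + 2) + 2 * d ^ 2 * (1 + k) + b ^ 2 * suc b
                       + t ^ 2 * 1 + j ^ 2)
           (∣m-m+n∣≡n b e) ⟩
    (1 + d) ^ 2 * (b * 1 + d * k + 2) + 2 * d ^ 2 * (1 + k) + b ^ 2 * suc b + e ^ 2 * 1 + j ^ 2
      ≡⟨ expand b e k ⟩
    base d k + 4 * d + 2 + j ^ 3 + d ^ 2 * (suc b + 2 + 2 * (1 + 0)) ∎)
    where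
    swap : ∀ x y z → x + y + z ≡ x + z + y
    swap = solve-∀
    expand : ∀ b e k →
      (1 + (b + e)) * ((1 + (b + e)) * 1) * (b * 1 + (b + e) * k + 2)
        + 2 * ((b + e) * ((b + e) * 1)) * (1 + k) + b * (b * 1) * (1 + b) + e * (e * 1) * 1
        + (1 + b) * ((1 + b) * 1) ≡
      k * ((b + e) * ((1 + (b + e)) * ((1 + (b + e)) * 1) + 2 * (b + e))) + 4 * (b + e) + 2
        + (1 + b) * ((1 + b) * ((1 + b) * 1))
        + (b + e) * ((b + e) * 1) * (1 + b + 2 + 2 * (1 + 0))
    expand = solve-∀

-- Comparing the three values.

-- Reduces an inequality between polynomials to an identity for the ring solver; the slack `r` is
-- then a polynomial with natural coefficients.
<-by : ∀ {m n} r → m + suc r ≡ n → m < n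
<-by {m} r refl = subst (_≤ m + suc r) (+-comm m 1) (+-monoʳ-≤ m (s≤s z≤n))

module _ {i c k σ′ σ″ : ℕ}
  (value′ : σ′ ≡ base (i + c) k + (2 + i) * (2 * (i + c) + 1) + (2 + i) * i ^ 2) where
  open ≡-Reasoning

  private
    B = base (i + c) k

  -- σ″ - σ′ = (Δ - j) q(j), with j = 2 + i and Δ - j = c.
  compare-σ″ : σ″ + (i + c) ^ 3 ≡ B + 5 * (i + c) + 2 + 2 * (2 + i) * (i + c) ^ 2 →
    σ′ + c * (i * i + 6 * i + 1 + 4 * c) ≡ σ″ + c * (i * c + c * c)
  compare-σ″ value″ = +-cancelʳ-≡ ((i + c) ^ 3) _ _ (begin
    σ′ + c * (i * i + 6 * i + 1 + 4 * c) + (i + c) ^ 3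
      ≡⟨ cong (λ t → t + c * (i * i + 6 * i + 1 + 4 * c) + (i + c) ^ 3) value′ ⟩
    B + (2 + i) * (2 * (i + c) + 1) + (2 + i) * i ^ 2 + c * (i * i + 6 * i + 1 + 4 * c) + (i + c) ^ 3
      ≡⟨ expand B i c ⟩
    B + 5 * (i + c) + 2 + 2 * (2 + i) * (i + c) ^ 2 + c * (i * c + c * c)
      ≡⟨ cong (_+ c * (i * c + c * c)) value″ ⟨
    σ″ + (i + c) ^ 3 + c * (i * c + c * c)
      ≡⟨ swap σ″ ((i + c) ^ 3) (c * (i * c + c * c)) ⟩
    σ″ + c * (i * c + c * c) + (i + c) ^ 3 ∎)
    where
    swap : ∀ x y z → x + y + z ≡ x + z + y
    swap = solve-∀
    expand : ∀ b i c →
      b + (2 + i) * (2 * (i + c) + 1) + (2 + i) * (i * (i * 1)) + c * (i * i + 6 * i + 1 + 4 * c)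
        + (i + c) * ((i + c) * ((i + c) * 1)) ≡
      b + 5 * (i + c) + 2 + 2 * (2 + i) * ((i + c) * ((i + c) * 1)) + c * (i * c + c * c)
    expand = solve-∀

  compare-σ‴ : ∀ {σ‴} → σ‴ + (2 + i) ^ 2 ≡ B + 4 * (i + c) + 2 + (2 + i) ^ 3 →
    σ‴ + 2 * (i * c) ≡ σ′ + (i * (i + 7) + 4)
  compare-σ‴ {σ‴} value‴ = +-cancelʳ-≡ ((2 + i) ^ 2) _ _ (begin
    σ‴ + 2 * (i * c) + (2 + i) ^ 2
      ≡⟨ swap σ‴ (2 * (i * c)) ((2 + i) ^ 2) ⟩
    σ‴ + (2 + i) ^ 2 + 2 * (i * c)
      ≡⟨ cong (_+ 2 * (i * c)) value‴ ⟩
    B + 4 * (i + c) + 2 + (2 + i) ^ 3 + 2 * (i * c)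
      ≡⟨ expand B i c ⟩
    B + (2 + i) * (2 * (i + c) + 1) + (2 + i) * i ^ 2 + (i * (i + 7) + 4) + (2 + i) ^ 2
      ≡⟨ cong (λ t → t + (i * (i + 7) + 4) + (2 + i) ^ 2) value′ ⟨
    σ′ + (i * (i + 7) + 4) + (2 + i) ^ 2 ∎)
    where
    swap : ∀ x y z → x + y + z ≡ x + z + y
    swap = solve-∀
    expand : ∀ b i c →
      b + 4 * (i + c) + 2 + (2 + i) * ((2 + i) * ((2 + i) * 1)) + 2 * (i * c) ≡
      b + (2 + i) * (2 * (i + c) + 1) + (2 + i) * (i * (i * 1)) + (i * (i + 7) + 4)
        + (2 + i) * ((2 + i) * 1)
    expand = solve-∀

-- The last two inequalities are `σ‴ < σ′` and `σ‴ < σ″` with the values cancelled. In the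
-- exceptional ones (Δ, j) is (8, 3) or (9, 3), or j = 2, which includes (6, 2).
data Regime (i c : ℕ) : Set where
  exceptional-j≡2 : i ≡ 0 → Regime i c
  exceptional-8,3 : i ≡ 1 → c ≡ 5 → Regime i c
  exceptional-9,3 : i ≡ 1 → c ≡ 6 → Regime i c
  below-σ′ : i * (i + 7) + 4 < 2 * (i * c) → Regime i c
  below-σ″ : c * (i * c + c * c) + (i * (i + 7) + 4) <
             2 * (i * c) + c * (i * i + 6 * i + 1 + 4 * c) → Regime i c

-- For i ≥ 1 and c = 4 + s, the first inequality reads 4 < i (2 s + 1 - i).
regime : ∀ i c → 2 ≤ c → Regime i c
regime zero    _ _ = exceptional-j≡2 refl
regime (suc _) 1 (s≤s ())
regime i@(suc _) 2 _ = below-σ″ (<-by (i * i + 5 * i + 5) (expand i))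
  where
  expand : ∀ i → 2 * (i * 2 + 2 * 2) + (i * (i + 7) + 4) + (1 + (i * i + 5 * i + 5)) ≡
                 2 * (i * 2) + 2 * (i * i + 6 * i + 1 + 4 * 2)
  expand = solve-∀
regime i@(suc _) 3 _ = below-σ″ (<-by (2 * i * i + 8 * i + 7) (expand i))
  where
  expand : ∀ i → 3 * (i * 3 + 3 * 3) + (i * (i + 7) + 4) + (1 + (2 * i * i + 8 * i + 7)) ≡
                 2 * (i * 3) + 3 * (i * i + 6 * i + 1 + 4 * 3)
  expand = solve-∀
regime (suc i) (suc (suc (suc (suc s)))) _ with 2 * s ≤? i
-- In this branch σ‴ exceeds σ′, so the bound must come from σ″; at `i = 2 * s + t` its slack has
-- positive coefficients only.
... | yes 2s≤i with m≤n⇒∃[o]m+o≡n 2s≤i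
...   | t , refl = below-σ″ (<-by
  (11 + 16 * s + 7 * s * s + s * s * s + 15 * t + 3 * t * t + 14 * s * t + s * t * t + 3 * s * s * t)
  (expand s t))
  where
  expand : ∀ s t →
    (4 + s) * ((1 + (2 * s + t)) * (4 + s) + (4 + s) * (4 + s))
      + ((1 + (2 * s + t)) * ((1 + (2 * s + t)) + 7) + 4)
      + (1 + (11 + 16 * s + 7 * s * s + s * s * s + 15 * t + 3 * t * t + 14 * s * t + s * t * t
               + 3 * s * s * t)) ≡
    2 * ((1 + (2 * s + t)) * (4 + s))
      + (4 + s) * ((1 + (2 * s + t)) * (1 + (2 * s + t)) + 6 * (1 + (2 * s + t)) + 1 + 4 * (4 + s))
  expand = solve-∀
regime (suc i) (suc (suc (suc (suc s)))) _ | no 2s≰i with m≤n⇒∃[o]m+o≡n (≰⇒> 2s≰i)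
... | o , 1+i+o≡2s = gap s i o 1+i+o≡2s
  where
  -- The product to be compared with 4 is now `(1 + i) * (1 + o)`, that is `2 * s + i * o`, which
  -- exceeds 4 for all s ≥ 3. For s = 1 it is 2, and for s = 2 it is 4 or 6; where it does not
  -- exceed 4, either σ″ takes over or the case is exceptional.
  gap : ∀ s i o → suc i + o ≡ 2 * s → Regime (suc i) (4 + s)
  gap 0 i o ()
  gap 1 0 1 refl = exceptional-8,3 refl refl
  gap 1 1 0 refl = below-σ″ (<-by 7 refl)
  gap 1 (suc (suc i)) o ()
  gap 2 0 3 refl = exceptional-9,3 refl refl
  gap 2 1 2 refl = below-σ′ (<-by 1 refl)
  gap 2 2 1 refl = below-σ′ (<-by 1 refl)
  gap 2 3 0 refl = below-σ″ (<-by 29 refl)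
  gap 2 (suc (suc (suc (suc i)))) o ()
  gap (suc (suc (suc s))) i o eq = below-σ′ (<-by (1 + 2 * s + i * o) (begin
    (1 + i) * (1 + i + 7) + 4 + (1 + (1 + 2 * s + i * o))
      ≡⟨ regroup i s o ⟩
    (1 + i) * (1 + i + 7) + 2 * (3 + s) + i * o
      ≡⟨ cong (λ t → (1 + i) * (1 + i + 7) + t + i * o) eq ⟨
    (1 + i) * (1 + i + 7) + (1 + i + o) + i * o
      ≡⟨ factor i o ⟩
    (1 + i) * (1 + i + o + 8)
      ≡⟨ cong (λ t → (1 + i) * (t + 8)) eq ⟩
    (1 + i) * (2 * (3 + s) + 8)
      ≡⟨ double i s ⟩
    2 * ((1 + i) * (4 + (3 + s))) ∎))
    where
    open ≡-Reasoning
    regroup : ∀ i s o → (1 + i) * (1 + i + 7) + 4 + (1 + (1 + 2 * s + i * o)) ≡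
                        (1 + i) * (1 + i + 7) + 2 * (3 + s) + i * o
    regroup = solve-∀
    factor : ∀ i o → (1 + i) * (1 + i + 7) + (1 + i + o) + i * o ≡ (1 + i) * (1 + i + o + 8)
    factor = solve-∀
    double : ∀ i s → (1 + i) * (2 * (3 + s) + 8) ≡ 2 * ((1 + i) * (4 + (3 + s)))
    double = solve-∀

module _ {i c σ′ σ″ σ‴ : ℕ}
  (eq″ : σ′ + c * (i * i + 6 * i + 1 + 4 * c) ≡ σ″ + c * (i * c + c * c))
  (eq‴ : σ‴ + 2 * (i * c) ≡ σ′ + (i * (i + 7) + 4)) where

  σ‴<σ′ : i * (i + 7) + 4 < 2 * (i * c) → σ‴ < σ′
  σ‴<σ′ lt = +-cancelʳ-< (2 * (i * c)) σ‴ σ′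
    (subst (_< σ′ + 2 * (i * c)) (sym eq‴) (+-monoʳ-< σ′ lt))

  -- Adding `eq″` and `eq‴` eliminates σ′.
  σ‴<σ″ : c * (i * c + c * c) + (i * (i + 7) + 4) <
          2 * (i * c) + c * (i * i + 6 * i + 1 + 4 * c) → σ‴ < σ″
  σ‴<σ″ lt = +-cancelʳ-< (X + P) σ‴ σ″ (begin-strict
    σ‴ + (X + P)       ≡⟨ +-assoc σ‴ X P ⟨
    σ‴ + X + P         ≡⟨ cong (_+ P) eq‴ ⟩
    σ′ + F + P         ≡⟨ swap σ′ F P ⟩
    σ′ + P + F         ≡⟨ cong (_+ F) eq″ ⟩
    σ″ + Q + F         ≡⟨ +-assoc σ″ Q F ⟩
    σ″ + (Q + F)       <⟨ +-monoʳ-< σ″ lt ⟩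
    σ″ + (X + P)       ∎)
    where
    open ≤-Reasoning
    P = c * (i * i + 6 * i + 1 + 4 * c)
    Q = c * (i * c + c * c)
    X = 2 * (i * c)
    F = i * (i + 7) + 4
    swap : ∀ x y z → x + y + z ≡ x + z + y
    swap = solve-∀

  -- Here j = 2 + i and Δ = 2 + (i + c).
  σ‴-comparison : 2 ≤ c → 4 ≤ i + c → let j = 2 + i; Δ = 2 + (i + c) in
    (¬ ((j ≡ 2 × 7 ≤ Δ) ⊎ (Δ ≡ 8 × j ≡ 3) ⊎ (Δ ≡ 6 × j ≡ 2) ⊎ (Δ ≡ 9 × j ≡ 3)) →
      σ‴ < σ′ ⊔ σ″) ×
    (j ≡ 2 → 7 ≤ Δ → σ‴ ≡ σ′ + 4 × σ′ ⊔ σ″ < σ‴) ×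
    (Δ ≡ 8 → j ≡ 3 → σ‴ ≡ σ′ + 2 × σ′ ⊔ σ″ < σ‴) ×
    (Δ ≡ 6 → j ≡ 2 → σ‴ ≡ σ″ × σ′ < σ″) ×
    (Δ ≡ 9 → j ≡ 3 → σ‴ ≡ σ′ × σ″ < σ′)
  σ‴-comparison 2≤c 4≤d = generic , case-j≡2 , case-8,3 , case-6,2 , case-9,3
    where
    generic : _ → σ‴ < σ′ ⊔ σ″
    generic ¬exception with regime i c 2≤c
    ... | below-σ′ lt = <-≤-trans (σ‴<σ′ lt) (m≤m⊔n σ′ σ″)
    ... | below-σ″ lt = <-≤-trans (σ‴<σ″ lt) (m≤n⊔m σ′ σ″)
    ... | exceptional-8,3 refl refl = contradiction (inj₂ (inj₁ (refl , refl))) ¬exception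
    ... | exceptional-9,3 refl refl = contradiction (inj₂ (inj₂ (inj₂ (refl , refl)))) ¬exception
    ... | exceptional-j≡2 refl with c ≟ 4
    ...   | yes refl = contradiction (inj₂ (inj₂ (inj₁ (refl , refl)))) ¬exception
    ...   | no  c≢4  = contradiction (inj₁ (refl , s≤s (s≤s (≤∧≢⇒< 4≤d (c≢4 ∘ sym))))) ¬exception

    case-j≡2 : 2 + i ≡ 2 → 7 ≤ 2 + (i + c) → σ‴ ≡ σ′ + 4 × σ′ ⊔ σ″ < σ‴
    case-j≡2 refl 7≤Δ = σ‴≡ ,
      subst (σ′ ⊔ σ″ <_) (sym σ‴≡) (⊔-lub (m<m+n σ′ (s≤s z≤n)) (m≤n⇒m≤n+o 4 σ″<σ′))
      where
      σ‴≡ : σ‴ ≡ σ′ + 4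
      σ‴≡ = trans (sym (+-identityʳ σ‴)) eq‴

      -- The difference is c³ - 4c² - c, positive from c = 5 on. At c = 4 it is -4, which accounts
      -- for the case (Δ, j) = (6, 2).
      Q-P : ∀ e → let c = 5 + e in c * (0 * 0 + 6 * 0 + 1 + 4 * c)
            + (1 + (19 + 34 * e + 11 * e * e + e * e * e)) ≡ c * (0 * c + c * c)
      Q-P = solve-∀

      σ″<σ′ : σ″ < σ′
      σ″<σ′ with m≤n⇒∃[o]m+o≡n (s≤s⁻¹ (s≤s⁻¹ 7≤Δ))
      ... | e , refl = +-cancelʳ-< (c * (0 * 0 + 6 * 0 + 1 + 4 * c)) σ″ σ′
        (subst (σ″ + c * (0 * 0 + 6 * 0 + 1 + 4 * c) <_) (sym eq″)
          (+-monoʳ-< σ″ (<-by (19 + 34 * e + 11 * e * e + e * e * e) (Q-P e))))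

    -- The numerals in this and the next two cases are terms of `eq″` and `eq‴` evaluated at (i, c)
    -- = (1, 5), (0, 4) and (1, 6). Here `eq″` becomes σ′ + 140 = σ″ + 150.
    case-8,3 : 2 + (i + c) ≡ 8 → 2 + i ≡ 3 → σ‴ ≡ σ′ + 2 × σ′ ⊔ σ″ < σ‴
    case-8,3 refl refl = σ‴≡ ,
      subst (σ′ ⊔ σ″ <_) (sym σ‴≡) (⊔-lub (m<m+n σ′ (s≤s z≤n)) (m≤n⇒m≤n+o 2 σ″<σ′))
      where
      σ‴≡ : σ‴ ≡ σ′ + 2
      σ‴≡ = +-cancelʳ-≡ 10 σ‴ (σ′ + 2) (trans eq‴ (sym (+-assoc σ′ 2 10)))
      σ″<σ′ : σ″ < σ′
      σ″<σ′ = +-cancelʳ-< 140 σ″ σ′ (subst (σ″ + 140 <_) (sym eq″) (+-monoʳ-< σ″ (<-by 9 refl)))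

    case-6,2 : 2 + (i + c) ≡ 6 → 2 + i ≡ 2 → σ‴ ≡ σ″ × σ′ < σ″
    case-6,2 refl refl = trans (trans (sym (+-identityʳ σ‴)) eq‴) σ′+4≡ ,
      subst (σ′ <_) σ′+4≡ (m<m+n σ′ (s≤s z≤n))
      where
      σ′+4≡ : σ′ + 4 ≡ σ″
      σ′+4≡ = +-cancelʳ-≡ 64 (σ′ + 4) σ″ (trans (+-assoc σ′ 4 64) eq″)

    case-9,3 : 2 + (i + c) ≡ 9 → 2 + i ≡ 3 → σ‴ ≡ σ′ × σ″ < σ′
    case-9,3 refl refl = +-cancelʳ-≡ 12 σ‴ σ′ eq‴ ,
      +-cancelʳ-< 192 σ″ σ′ (subst (σ″ + 192 <_) (sym eq″) (+-monoʳ-< σ″ (<-by 59 refl)))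

-- From the position of j relative to r(Δ) to an inequality in ℕ.

ιᵘ : ℕ → ℚᵘ.ℚᵘ
ιᵘ a = ℚᵘ.mkℚᵘ (ℤ.+ a) 0

toℚᵘ-ι : ∀ a → ℚ.toℚᵘ (ι a) ℚᵘ.≃ ιᵘ a
toℚᵘ-ι a = ℚ.toℚᵘ-fromℚᵘ (ιᵘ a)

ι-+ : ∀ a b → ι (a + b) ≡ ι a ℚ.+ ι b
ι-+ a b = ℚ.toℚᵘ-injective (begin
  ℚ.toℚᵘ (ι (a + b))               ≈⟨ toℚᵘ-ι (a + b) ⟩
  ιᵘ (a + b)                       ≈⟨ ℚᵘ.*≡* (trans (cong (ℤ._* ℤ.+ 1) (ℤ.pos-+ a b)) (units (ℤ.+ a) (ℤ.+ b))) ⟩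
  ιᵘ a ℚᵘ.+ ιᵘ b                   ≈⟨ ℚᵘ.+-cong (toℚᵘ-ι a) (toℚᵘ-ι b) ⟨
  ℚ.toℚᵘ (ι a) ℚᵘ.+ ℚ.toℚᵘ (ι b)   ≈⟨ ℚ.toℚᵘ-homo-+ (ι a) (ι b) ⟨
  ℚ.toℚᵘ (ι a ℚ.+ ι b)             ∎)
  where
  open ℚᵘ.≃-Reasoning
  units : ∀ x y → (x ℤ.+ y) ℤ.* ℤ.+ 1 ≡ (x ℤ.* ℤ.+ 1 ℤ.+ y ℤ.* ℤ.+ 1) ℤ.* ℤ.+ 1
  units = solveℤ-∀

ι-* : ∀ a b → ι (a * b) ≡ ι a ℚ.* ι b
ι-* a b = ℚ.toℚᵘ-injective (begin
  ℚ.toℚᵘ (ι (a * b))               ≈⟨ toℚᵘ-ι (a * b) ⟩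
  ιᵘ (a * b)                       ≈⟨ ℚᵘ.*≡* (cong (ℤ._* ℤ.+ 1) (ℤ.pos-* a b)) ⟩
  ιᵘ a ℚᵘ.* ιᵘ b                   ≈⟨ ℚᵘ.*-cong (toℚᵘ-ι a) (toℚᵘ-ι b) ⟨
  ℚ.toℚᵘ (ι a) ℚᵘ.* ℚ.toℚᵘ (ι b)   ≈⟨ ℚ.toℚᵘ-homo-* (ι a) (ι b) ⟨
  ℚ.toℚᵘ (ι a ℚ.* ι b)             ∎)
  where open ℚᵘ.≃-Reasoning

ι-mono-< : ∀ {a b} → a < b → ι a ℚ.< ι b
ι-mono-< {a} {b} a<b = ℚ.toℚᵘ-cancel-<
  (ℚᵘ.<-respˡ-≃ (ℚᵘ.≃-sym (toℚᵘ-ι a)) (ℚᵘ.<-respʳ-≃ (ℚᵘ.≃-sym (toℚᵘ-ι b))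
    (ℚᵘ.*<* (ℤ.*-monoʳ-<-pos (ℤ.+ 1) (ℤ.+<+ a<b)))))

ι-cancel-< : ∀ {a b} → ι a ℚ.< ι b → a < b
ι-cancel-< {a} {b} ιa<ιb with <-cmp a b
... | tri< a<b _ _  = a<b
... | tri≈ _ refl _ = contradiction ιa<ιb (ℚ.<-irrefl refl)
... | tri> _ _ b<a  = contradiction ιa<ιb (ℚ.<-asym (ι-mono-< b<a))

-- q(j) = P - Q, rearranged to avoid subtraction.
P Q : ℕ → ℕ → ℕ
P Δ j = j * j + Δ * j + 6 * Δ
Q Δ j = 4 * j + Δ * Δ + 7

qpoly-ι : ∀ Δ j → qpoly Δ (ι j) ≡ ι (P Δ j) ℚ.- ι (Q Δ j)
qpoly-ι Δ j = trans
  (solve 2 (λ d x →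
    x :* x :+ (d :- con (ι 4)) :* x :- (d :* d :- con (ι 6) :* d :+ con (ι 7)) :=
    x :* x :+ d :* x :+ con (ι 6) :* d :- (con (ι 4) :* x :+ d :* d :+ con (ι 7))) refl (ι Δ) (ι j))
  (sym (cong₂ ℚ._-_
    (trans (ι-+ (j * j + Δ * j) (6 * Δ)) (cong₂ ℚ._+_
      (trans (ι-+ (j * j) (Δ * j)) (cong₂ ℚ._+_ (ι-* j j) (ι-* Δ j))) (ι-* 6 Δ)))
    (trans (ι-+ (4 * j + Δ * Δ) 7) (cong (ℚ._+ ι 7)
      (trans (ι-+ (4 * j) (Δ * Δ)) (cong₂ ℚ._+_ (ι-* 4 j) (ι-* Δ Δ)))))))
  where open +-*-Solver

private
  minus-plus : ∀ p q → p ℚ.- q ℚ.+ q ≡ p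
  minus-plus = solve 2 (λ p q → p :- q :+ q := p) refl
    where open +-*-Solver

qpoly<0⇒P<Q : ∀ Δ j → qpoly Δ (ι j) ℚ.< ℚ.0ℚ → P Δ j < Q Δ j
qpoly<0⇒P<Q Δ j q<0 = ι-cancel-< (subst₂ ℚ._<_
  (trans (cong (ℚ._+ ι (Q Δ j)) (qpoly-ι Δ j)) (minus-plus (ι (P Δ j)) (ι (Q Δ j))))
  (ℚ.+-identityˡ (ι (Q Δ j))) (ℚ.+-monoˡ-< (ι (Q Δ j)) q<0))

0<qpoly⇒Q<P : ∀ Δ j → ℚ.0ℚ ℚ.< qpoly Δ (ι j) → Q Δ j < P Δ j
0<qpoly⇒Q<P Δ j 0<q = ι-cancel-< (subst₂ ℚ._<_
  (ℚ.+-identityˡ (ι (Q Δ j)))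
  (trans (cong (ℚ._+ ι (Q Δ j)) (qpoly-ι Δ j)) (minus-plus (ι (P Δ j)) (ι (Q Δ j))))
  (ℚ.+-monoˡ-< (ι (Q Δ j)) 0<q))

P<Q⇒qpoly<0 : ∀ Δ j → P Δ j < Q Δ j → qpoly Δ (ι j) ℚ.< ℚ.0ℚ
P<Q⇒qpoly<0 Δ j P<Q = subst₂ ℚ._<_ (sym (qpoly-ι Δ j)) (ℚ.+-inverseʳ (ι (Q Δ j)))
  (ℚ.+-monoˡ-< (ℚ.- ι (Q Δ j)) (ι-mono-< P<Q))

Q<P⇒0<qpoly : ∀ Δ j → Q Δ j < P Δ j → ℚ.0ℚ ℚ.< qpoly Δ (ι j)
Q<P⇒0<qpoly Δ j Q<P = subst₂ ℚ._<_ (ℚ.+-inverseʳ (ι (Q Δ j))) (sym (qpoly-ι Δ j))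
  (ℚ.+-monoˡ-< (ℚ.- ι (Q Δ j)) (ι-mono-< Q<P))

module _ {Δ j : ℕ} (6≤Δ : 6 ≤ Δ) (1≤j : 1 ≤ j) where
  private
    root = r-root Δ 6≤Δ (ι j) (ι-mono-< 1≤j)
    L⇔ = proj₁ root
    U⇔ = proj₂ root

  -- Roundedness moves membership in the lower cut from the witness `p` down to `ι j`, where
  -- `r-root` gives the sign of q.
  below-r : fromℚ (ι j) <ᴿ r Δ → P Δ j < Q Δ j
  below-r (p , j<p , Lp) = qpoly<0⇒P<Q Δ j (Equivalence.to L⇔
    (Equivalence.from (ℝ.L-rounded (r Δ) (ι j)) (p , j<p , Lp)))

  above-r : r Δ <ᴿ fromℚ (ι j) → Q Δ j < P Δ j
  above-r (p , Up , p<j) = 0<qpoly⇒Q<P Δ j (Equivalence.to U⇔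
    (Equivalence.from (ℝ.U-rounded (r Δ) (ι j)) (p , p<j , Up)))

  -- If q(j) had a sign, `ι j` would lie in one half of the cut `r Δ`, hence in the same half of its
  -- own cut, which means `ι j < ι j`.
  equals-r : fromℚ (ι j) ≈ᴿ r Δ → P Δ j ≡ Q Δ j
  equals-r (L≈ , U≈) with <-cmp (P Δ j) (Q Δ j)
  ... | tri≈ _ P≡Q _ = P≡Q
  ... | tri< P<Q _ _ = contradiction
    (Equivalence.from (L≈ (ι j)) (Equivalence.from L⇔ (P<Q⇒qpoly<0 Δ j P<Q))) (ℚ.<-irrefl refl)
  ... | tri> _ _ Q<P = contradiction
    (Equivalence.from (U≈ (ι j)) (Equivalence.from U⇔ (Q<P⇒0<qpoly Δ j Q<P))) (ℚ.<-irrefl refl)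

-- Order of σ′ and σ″ from the sign of q, and conclusion.

SameOrder : (p q σ′ σ″ : ℕ) → Set
SameOrder p q σ′ σ″ = (p < q → σ″ < σ′) × (p ≡ q → σ′ ≡ σ″) × (q < p → σ′ < σ″)

-- Dropping the common `z` leaves `x` and `y`, the two factors from `compare-σ″`. Their multiplier
-- `suc c` stands for Δ - j and can be cancelled because it is positive.
sameOrder : ∀ {p q x y z σ′ σ″} c → p ≡ x + z → q ≡ y + z →
            σ′ + suc c * x ≡ σ″ + suc c * y → SameOrder p q σ′ σ″
sameOrder {x = x} {y} {z} {σ′} {σ″} c refl refl eq =
  (λ lt → +-cancelʳ-< (suc c * x) σ″ σ′ (subst (σ″ + suc c * x <_) (sym eq)
            (+-monoʳ-< σ″ (*-monoʳ-< (suc c) (+-cancelʳ-< z x y lt))))) ,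
  (λ x≡y → +-cancelʳ-≡ (suc c * x) σ′ σ″
            (trans eq (cong (λ t → σ″ + suc c * t) (sym (+-cancelʳ-≡ z x y x≡y))))) ,
  (λ lt → +-cancelʳ-< (suc c * y) σ′ σ″ (subst (σ′ + suc c * y <_) eq
            (+-monoʳ-< σ′ (*-monoʳ-< (suc c) (+-cancelʳ-< z y x lt)))))

module _ {d k j σ″ : ℕ} (4≤d : 4 ≤ d)
  (value″ : σ″ + d ^ 3 ≡ base d k + 5 * d + 2 + 2 * j * d ^ 2) where

  -- At j = 1 the value of σ′ does not follow the cubic formula behind `compare-σ″`. As q(1) = -(Δ -
  -- 2)(Δ - 5) is negative, it remains to show `σ″ < σ′`; the other two premises are contradictory.
  sameOrder-1 : ∀ {σ′} → j ≡ 1 → σ′ ≡ base d k + 4 * d + 2 → SameOrder (P (2 + d) j) (Q (2 + d) j) σ′ σ″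
  sameOrder-1 {σ′} refl refl with m≤n⇒∃[o]m+o≡n 4≤d
  ... | e , refl = (λ _ → σ″<σ′) , (λ P≡Q → contradiction P≡Q (<⇒≢ P<Q)) ,
                   (λ Q<P → contradiction Q<P (<-asym P<Q))
    where
    P-Q : ∀ e → 1 * 1 + (2 + (4 + e)) * 1 + 6 * (2 + (4 + e)) + (1 + (3 + 5 * e + e * e)) ≡
                4 * 1 + (2 + (4 + e)) * (2 + (4 + e)) + 7
    P-Q = solve-∀
    P<Q : P (2 + d) 1 < Q (2 + d) 1
    P<Q = <-by (3 + 5 * e + e * e) (P-Q e)

    gap : ∀ b e → let d = 4 + e in
      b + 5 * d + 2 + 2 * 1 * (d * (d * 1)) + (1 + (27 + 31 * e + 10 * e * e + e * e * e)) ≡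
      b + 4 * d + 2 + d * (d * (d * 1))
    gap = solve-∀
    σ″<σ′ : σ″ < σ′
    σ″<σ′ = +-cancelʳ-< (d ^ 3) σ″ σ′ (subst (_< σ′ + d ^ 3) (sym value″)
      (<-by (27 + 31 * e + 10 * e * e + e * e * e) (gap (base d k) e)))

sameOrder-2+ : ∀ {i c σ′ σ″} →
  σ′ + suc c * (i * i + 6 * i + 1 + 4 * suc c) ≡ σ″ + suc c * (i * suc c + suc c * suc c) →
  SameOrder (P (2 + (i + suc c)) (2 + i)) (Q (2 + (i + suc c)) (2 + i)) σ′ σ″
sameOrder-2+ {i} {c} {σ′} {σ″} = sameOrder c (P-split i (suc c)) (Q-split i (suc c))
  where
  P-split : ∀ i c → (2 + i) * (2 + i) + (2 + (i + c)) * (2 + i) + 6 * (2 + (i + c)) ≡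
            i * i + 6 * i + 1 + 4 * c + (i * i + i * c + 8 * i + 4 * c + 19)
  P-split = solve-∀
  Q-split : ∀ i c → 4 * (2 + i) + (2 + (i + c)) * (2 + (i + c)) + 7 ≡
            i * c + c * c + (i * i + i * c + 8 * i + 4 * c + 19)
  Q-split = solve-∀

-- At j = 2 the value found for `m₂₂` = 2 agrees with the cubic formula at i = 0, so only j = 1
-- stands apart.
σ′Formula : (d k j v : ℕ) → Set
σ′Formula d k j v =
  (j ≡ 1 × v ≡ base d k + 4 * d + 2) ⊎
  (∃[ i ] j ≡ 2 + i × v ≡ base d k + (2 + i) * (2 * d + 1) + (2 + i) * i ^ 2)

module _ {d k j : ℕ} (4≤d : 4 ≤ d) (1≤j : 1 ≤ j) (j≤1+d : j ≤ 1 + d) where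
  private
    N = k * (2 + d) + j

  σ′-value : ∀ {v} →
    (∃[ s ] ∃[ nΔ ] 1 ≤ s × s ≤ 2 × Balance d 1 N 0 nΔ s 0 0 0 v) ⊎
    (∃[ b ] ∃[ nΔ ] 1 ≤ b × b < d × Balance d b N 1 nΔ 0 (2 + b) 0 0 v) →
    σ′Formula d k j v
  σ′-value (inj₂ (b , nΔ , _ , b<d , B)) =
    let (2+b≡j , eq) = σ′-large {d} {k} 1≤j j≤1+d 4≤d b<d B in inj₂ (b , sym 2+b≡j , eq)
  σ′-value {v} (inj₁ (s , nΔ , 1≤s , s≤2 , B)) =
    let (s≡j , eq) = σ′-small {d} {k} 1≤j j≤1+d 4≤d s≤2 B in small s 1≤s s≤2 (sym s≡j) eq
    where
    widen : ∀ b d → b + 4 * d + 2 ≡ b + (2 + 0) * (2 * d + 1) + (2 + 0) * (0 * (0 * 1))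
    widen = solve-∀
    small : ∀ s → 1 ≤ s → s ≤ 2 → j ≡ s → v ≡ base d k + 4 * d + 2 → σ′Formula d k j v
    small 1 _ _ j≡1 eq = inj₁ (j≡1 , eq)
    small 2 _ _ j≡2 eq = inj₂ (0 , j≡2 , trans eq (widen (base d k) d))
    small (suc (suc (suc _))) _ (s≤s (s≤s ())) _ _

  σ′-formula : ∀ {s} → CommonσValue (𝒯′ (suc N) (2 + d)) s → σ′Formula d k j s
  σ′-formula ((T , T∈) , common) =
    subst (σ′Formula d k j) (common T T∈) (σ′-value (𝒯′-balance 4≤d T T∈))

  σ″-formula : ∀ {s} → CommonσValue (𝒯″ (suc N) (2 + d)) s →
    s + d ^ 3 ≡ base d k + 5 * d + 2 + 2 * j * d ^ 2
  σ″-formula ((T , T∈) , common) =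
    subst (λ s → s + d ^ 3 ≡ base d k + 5 * d + 2 + 2 * j * d ^ 2) (common T T∈)
      (let (_ , _ , c≤1+d , B) = 𝒯″-balance 4≤d T T∈ in σ″-value {d} {k} 1≤j j≤1+d 4≤d c≤1+d B)

  σ‴-formula : ∀ {s} → 2 ≤ j → j ≤ d → CommonσValue (𝒯‴ (suc N) (2 + d) j) s →
    s + j ^ 2 ≡ base d k + 4 * d + 2 + j ^ 3
  σ‴-formula 2≤j j≤d ((T , T∈) , common) =
    subst (λ s → s + j ^ 2 ≡ base d k + 4 * d + 2 + j ^ 3) (common T T∈)
      (σ‴-value {d} {k} 1≤j j≤1+d 4≤d b<d j≡1+b (proj₂ (𝒯‴-balance 4≤d T j≡1+b (∸-monoˡ-≤ 1 2≤j) b<d T∈)))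
    where
    j≡1+b : j ≡ suc (j ∸ 1)
    j≡1+b = sym (m+[n∸m]≡n 1≤j)
    b<d : j ∸ 1 < d
    b<d = subst (_≤ d) j≡1+b j≤d

  σ′-σ″-order : ∀ {σ′ σ″} → σ′Formula d k j σ′ →
    σ″ + d ^ 3 ≡ base d k + 5 * d + 2 + 2 * j * d ^ 2 →
    SameOrder (P (2 + d) j) (Q (2 + d) j) σ′ σ″
  σ′-σ″-order (inj₁ (j≡1 , eq)) value″ = sameOrder-1 {d} {k} 4≤d value″ j≡1 eq
  σ′-σ″-order (inj₂ (i , refl , eq)) value″ with m≤n⇒∃[o]m+o≡n {suc i} {d} (s≤s⁻¹ j≤1+d)
  ... | c , 1+i+c≡d with trans (+-suc i c) 1+i+c≡d
  ...   | refl = sameOrder-2+ {i} {c} (compare-σ″ {i} {suc c} {k} eq value″)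

ComparisonOfσ‴ : (Δ j σ′ σ″ σ‴ : ℕ) → Set
ComparisonOfσ‴ Δ j σ′ σ″ σ‴ =
  (¬ ((j ≡ 2 × 7 ≤ Δ) ⊎ (Δ ≡ 8 × j ≡ 3) ⊎ (Δ ≡ 6 × j ≡ 2) ⊎ (Δ ≡ 9 × j ≡ 3)) →
    σ‴ < σ′ ⊔ σ″) ×
  (j ≡ 2 → 7 ≤ Δ → σ‴ ≡ σ′ + 4 × σ′ ⊔ σ″ < σ‴) ×
  (Δ ≡ 8 → j ≡ 3 → σ‴ ≡ σ′ + 2 × σ′ ⊔ σ″ < σ‴) ×
  (Δ ≡ 6 → j ≡ 2 → σ‴ ≡ σ″ × σ′ < σ″) ×
  (Δ ≡ 9 → j ≡ 3 → σ‴ ≡ σ′ × σ″ < σ′)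

compare-σ‴-max : ∀ {d k j σ′ σ″ σ‴} → 4 ≤ d → 2 ≤ j → j ≤ d → σ′Formula d k j σ′ →
  σ″ + d ^ 3 ≡ base d k + 5 * d + 2 + 2 * j * d ^ 2 →
  σ‴ + j ^ 2 ≡ base d k + 4 * d + 2 + j ^ 3 →
  ComparisonOfσ‴ (2 + d) j σ′ σ″ σ‴
compare-σ‴-max _ (s≤s ()) _ (inj₁ (refl , _)) _ _
compare-σ‴-max {d} {k} {_} {σ′} {σ″} 4≤d _ j≤d (inj₂ (i , refl , eq)) value″ value‴
  -- The bound `j ≤ d` gives Δ - j the form `2 + c`, which provides the lower bound 2 asked for by
  -- `regime`.
  with m≤n⇒∃[o]m+o≡n j≤d
... | c , 2+i+c≡d with trans (trans (+-suc i (suc c)) (cong suc (+-suc i c))) 2+i+c≡d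
...   | refl = σ‴-comparison {i} {2 + c}
  (compare-σ″ {i} {2 + c} {k} eq value″)
  (compare-σ‴ {i} {2 + c} {k} {σ′} {σ″} eq value‴)
  (s≤s (s≤s z≤n)) 4≤d

proposition10 : ∀ (Δ k j n : ℕ) → 6 ≤ Δ → n ≡ k * Δ + 1 + j →
    Δ ∸ 1 ≤ k → 1 ≤ j → j ≤ Δ ∸ 1 →
    ∀ (σ′ σ″ : ℕ) → CommonσValue (𝒯′ n Δ) σ′ → CommonσValue (𝒯″ n Δ) σ″ →
    (fromℚ (ι j) <ᴿ r Δ → σ″ < σ′) ×
    (fromℚ (ι j) ≈ᴿ r Δ → σ′ ≡ σ″) ×
    (r Δ <ᴿ fromℚ (ι j) → σ′ < σ″) ×
    (2 ≤ j → j ≤ Δ ∸ 2 →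
    ∀ (σ‴ : ℕ) → CommonσValue (𝒯‴ n Δ j) σ‴ →
    (¬ ((j ≡ 2 × 7 ≤ Δ) ⊎ (Δ ≡ 8 × j ≡ 3) ⊎ (Δ ≡ 6 × j ≡ 2) ⊎ (Δ ≡ 9 × j ≡ 3)) →
    σ‴ < σ′ ⊔ σ″) ×
    (j ≡ 2 → 7 ≤ Δ → σ‴ ≡ σ′ + 4 × σ′ ⊔ σ″ < σ‴) ×
    (Δ ≡ 8 → j ≡ 3 → σ‴ ≡ σ′ + 2 × σ′ ⊔ σ″ < σ‴) ×
    (Δ ≡ 6 → j ≡ 2 → σ‴ ≡ σ″ × σ′ < σ″) ×
    (Δ ≡ 9 → j ≡ 3 → σ‴ ≡ σ′ × σ″ < σ′))
proposition10 Δ k j n 6≤Δ n≡ _ = from-d (m≤n⇒∃[o]m+o≡n (≤-trans (s≤s (s≤s z≤n)) 6≤Δ))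
  (trans n≡ (cong (_+ j) (+-comm (k * Δ) 1))) 6≤Δ
  where
  from-d : ∀ {Δ n} → ∃[ d ] 2 + d ≡ Δ → n ≡ suc (k * Δ + j) → 6 ≤ Δ → 1 ≤ j → j ≤ Δ ∸ 1 →
    ∀ σ′ σ″ → CommonσValue (𝒯′ n Δ) σ′ → CommonσValue (𝒯″ n Δ) σ″ →
    (fromℚ (ι j) <ᴿ r Δ → σ″ < σ′) ×
    (fromℚ (ι j) ≈ᴿ r Δ → σ′ ≡ σ″) ×
    (r Δ <ᴿ fromℚ (ι j) → σ′ < σ″) ×
    (2 ≤ j → j ≤ Δ ∸ 2 → ∀ σ‴ → CommonσValue (𝒯‴ n Δ j) σ‴ → ComparisonOfσ‴ Δ j σ′ σ″ σ‴)
  from-d {Δ} (d , refl) refl 6≤Δ 1≤j j≤Δ-1 σ′ σ″ C′ C″ =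
    (λ j<r → proj₁ order (below-r {Δ} {j} 6≤Δ 1≤j j<r)) ,
    (λ j≈r → proj₁ (proj₂ order) (equals-r {Δ} {j} 6≤Δ 1≤j j≈r)) ,
    (λ r<j → proj₂ (proj₂ order) (above-r {Δ} {j} 6≤Δ 1≤j r<j)) ,
    (λ 2≤j j≤d σ‴ C‴ → compare-σ‴-max {d} {k} {j} 4≤d 2≤j j≤d formula′ formula″
      (σ‴-formula {d} {k} 4≤d 1≤j j≤Δ-1 2≤j j≤d C‴))
    where
    4≤d : 4 ≤ d
    4≤d = s≤s⁻¹ (s≤s⁻¹ 6≤Δ)
    formula′ = σ′-formula {d} {k} 4≤d 1≤j j≤Δ-1 C′
    formula″ = σ″-formula {d} {k} 4≤d 1≤j j≤Δ-1 C″
    order = σ′-σ″-order {d} {k} 4≤d 1≤j j≤Δ-1 formula′ formula″
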